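{- For each positive integer $n$, place $n$ queens at random on the $n\times n$ chessboard, let $S_n$ be the number of safe spaces and let $\mu_n=\mathbb{E}[S_n]/n^2$ be the expected proportion of safe spaces. Then, as $n\to\infty$, $\mathbb{E}[S_n]$ is asymptotic to $2n^2/e^4$, and $\mu_n$ converges to $2/e^4$.
   Context: The $n\times n$ board is the set of spaces $\{1,\dots,n\}^2$. "Placing $n$ pieces at random" means that the set of occupied spaces (the board configuration) is chosen uniformly among all $\binom{n^2}{n}$ subsets of $n$ distinct spaces. A queen at $(i,j)$ attacks every space $(x,y)$ on the board with $x=i$, or $y=j$, or $|x-i|=|y-j|$ (row, column and the two diagonals through $(i,j)$). A space is safe under a board configuration if it is neither occupied nor attacked by any of the placed pieces. -}

module Defs where

open import Data.Empty using (⊥-elim)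
open import Data.Fin using (Fin; toℕ; combine)
open import Data.Fin.Properties using (all?) renaming (_≟_ to _≟ᶠ_)
open import Data.Fin.Subset using (Subset; inside; outside; _∈_) renaming (∣_∣ to size)
open import Data.Fin.Subset.Properties using (_∈?_)
open import Data.Integer using (+_; -[1+_]; +[1+_])
import Data.Integer as ℤ
import Data.Integer.Properties as ℤₚ
open import Data.List using (List; []; _∷_; [_]; _++_; map; filter; length; allFin; cartesianProduct)
open import Data.List.Relation.Unary.Any using (here; there)
import Data.List.Membership.Propositional as List
open import Data.List.Membership.Propositional.Properties using (∈-map⁺; ∈-++⁺ˡ; ∈-++⁺ʳ; ∈-filter⁺)
open import Data.Nat using (ℕ; zero; suc; z≤n; s≤s; _!)
import Data.Nat as ℕ
open import Data.Nat.ListAction using (sum)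
import Data.Nat.Properties as ℕₚ
open import Data.Product using (_×_; _,_; Σ; ∃-syntax)
open import Data.Rational using (ℚ; mkℚ; 0ℚ; 1ℚ; ½)
import Data.Rational as ℚ
import Data.Rational.Properties as ℚₚ
import Data.Rational.Unnormalised as ℚᵘ
import Data.Rational.Unnormalised.Properties as ℚᵘₚ
open import Data.Rational.Solver using (module +-*-Solver)
open import Data.Sum using (_⊎_; inj₁; inj₂)
open import Data.Vec using ([]; _∷_)
open import Relation.Binary.PropositionalEquality using (_≡_; _≢_; refl; sym; trans; cong; cong₂; subst)
open import Relation.Nullary using (¬_; Dec; ¬?)
open import Relation.Nullary.Decidable using (_×-dec_; _⊎-dec_; _→-dec_)
open import Relation.Unary using (Decidable)

-- Coordinates are 0-based; attacks depend only on coordinate differences.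
Space : ℕ → Set
Space n = Fin n × Fin n

-- Sets of spaces, via the bijection combine : Fin n × Fin n → Fin (n * n).
Configuration : ℕ → Set
Configuration n = Subset (n ℕ.* n)

Occupied : ∀ n → Configuration n → Space n → Set
Occupied n p (i , j) = combine i j ∈ p

Attacks : ∀ {n} → Space n → Space n → Set
Attacks (i , j) (x , y) =
  x ≡ i ⊎ y ≡ j ⊎ ℕ.∣ toℕ x - toℕ i ∣ ≡ ℕ.∣ toℕ y - toℕ j ∣

Safe : ∀ n → Configuration n → Space n → Set
Safe n p s = ¬ Occupied n p s × (∀ i j → Occupied n p (i , j) → ¬ Attacks (i , j) s)

attacks? : ∀ {n} (s t : Space n) → Dec (Attacks s t)
attacks? (i , j) (x , y) =
  (x ≟ᶠ i) ⊎-dec ((y ≟ᶠ j) ⊎-dec (ℕ.∣ toℕ x - toℕ i ∣ ℕ.≟ ℕ.∣ toℕ y - toℕ j ∣))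

safe? : ∀ n (p : Configuration n) → Decidable (Safe n p)
safe? n p s@(x , y) =
  ¬? (combine x y ∈? p) ×-dec
  all? (λ i → all? (λ j → (combine i j ∈? p) →-dec ¬? (attacks? (i , j) s)))

safeCount : ∀ n → Configuration n → ℕ
safeCount n p = length (filter (safe? n p) (cartesianProduct (allFin n) (allFin n)))

allSubsets : ∀ m → List (Subset m)
allSubsets zero    = [ [] ]
allSubsets (suc m) = map (outside ∷_) (allSubsets m) ++ map (inside ∷_) (allSubsets m)

placements : ∀ n → List (Configuration n)
placements n = filter (λ p → size p ℕ.≟ n) (allSubsets (n ℕ.* n))

module PlacementLemmas where
  subsetOfSize : ∀ {k m} → k ℕ.≤ m → ∃[ p ] (p List.∈ allSubsets m × size p ≡ k)
  subsetOfSize {m = zero} z≤n = [] , here refl , refl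
  subsetOfSize {m = suc m} z≤n with p , p∈ , eq ← subsetOfSize {m = m} z≤n =
    outside ∷ p , ∈-++⁺ˡ (∈-map⁺ (outside ∷_) p∈) , eq
  subsetOfSize {m = suc m} (s≤s k≤m) with p , p∈ , eq ← subsetOfSize k≤m =
    inside ∷ p , ∈-++⁺ʳ (map (outside ∷_) (allSubsets m)) (∈-map⁺ (inside ∷_) p∈) , cong suc eq

  n≤n*n : ∀ n → n ℕ.≤ n ℕ.* n
  n≤n*n zero    = z≤n
  n≤n*n (suc n) = ℕₚ.m≤m+n (suc n) _

  ∈⇒nonZero : ∀ {A : Set} {x : A} {xs} → x List.∈ xs → ℕ.NonZero (length xs)
  ∈⇒nonZero (here _)  = _
  ∈⇒nonZero (there _) = _

open PlacementLemmas

placements-nonEmpty : ∀ n → ℕ.NonZero (length (placements n))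
placements-nonEmpty n with p , p∈ , eq ← subsetOfSize (n≤n*n n) =
  ∈⇒nonZero (∈-filter⁺ (λ p → size p ℕ.≟ n) p∈ eq)

mean : ∀ {A : Set} → (A → ℕ) → (xs : List A) → .{{ℕ.NonZero (length xs)}} → ℚ
mean f xs = + sum (map f xs) ℚ./ length xs

𝔼S : ℕ → ℚ
𝔼S n = mean (safeCount n) (placements n) {{placements-nonEmpty n}}

μ : (n : ℕ) → .{{ℕ.NonZero n}} → ℚ
μ n = 𝔼S n ℚ.* (+ 1 ℚ./ (n ℕ.* n)) {{ℕₚ.m*n≢0 n n}}

-- The standard library has no real numbers; ℝ is the type of Cauchy sequences
-- of rationals, with equality of reals left implicit since only < is needed.

Cauchy : (ℕ → ℚ) → Set
Cauchy s = ∀ ε → 0ℚ ℚ.< ε →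
  ∃[ N ] (∀ m n → N ℕ.≤ m → N ℕ.≤ n → ℚ.∣ s m ℚ.- s n ∣ ℚ.≤ ε)

record ℝ : Set where
  constructor real
  field
    seq    : ℕ → ℚ
    cauchy : Cauchy seq

open ℝ public

infix 4 _<_

_<_ : ℝ → ℝ → Set
x < y = ∃[ δ ] (0ℚ ℚ.< δ × ∃[ N ] (∀ n → N ℕ.≤ n → seq x n ℚ.+ δ ℚ.≤ seq y n))

-- 1/p, totalised by recip 0 = 0; _÷_ below applies it to a sequence that is
-- eventually bounded away from 0.
recip : ℚ → ℚ
recip   (mkℚ (+ 0)    _ _) = 0ℚ
recip p@(mkℚ +[1+ _ ] _ _) = ℚ.1/ p
recip p@(mkℚ -[1+ _ ] _ _) = ℚ.1/ p

-- Σ1/k! n is the sum of 1/k! over k < n.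
Σ1/k! : ℕ → ℚ
Σ1/k! zero    = 0ℚ
Σ1/k! (suc n) = Σ1/k! n ℚ.+ (+ 1 ℚ./ n !) {{n ℕₚ.!≢0}}

open ℚₚ.≤-Reasoning

module CauchyLemmas where

  0≤ : ∀ {p} → 0ℚ ℚ.< p → 0ℚ ℚ.≤ p
  0≤ = ℚₚ.<⇒≤

  *-monoˡ : ∀ {r p q} → 0ℚ ℚ.≤ r → p ℚ.≤ q → r ℚ.* p ℚ.≤ r ℚ.* q
  *-monoˡ {r} 0≤r = ℚₚ.*-monoˡ-≤-nonNeg r {{ℚ.nonNegative 0≤r}}

  *-monoʳ : ∀ {r p q} → 0ℚ ℚ.≤ r → p ℚ.≤ q → p ℚ.* r ℚ.≤ q ℚ.* r
  *-monoʳ {r} 0≤r = ℚₚ.*-monoʳ-≤-nonNeg r {{ℚ.nonNegative 0≤r}}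

  *-pos : ∀ {p q} → 0ℚ ℚ.< p → 0ℚ ℚ.< q → 0ℚ ℚ.< p ℚ.* q
  *-pos {p} {q} 0<p 0<q =
    ℚₚ.positive⁻¹ _ {{ℚₚ.pos*pos⇒pos p {{ℚ.positive 0<p}} q {{ℚ.positive 0<q}}}}

  0<½ : 0ℚ ℚ.< ½
  0<½ = ℚₚ.positive⁻¹ ½

  0<1 : 0ℚ ℚ.< 1ℚ
  0<1 = ℚₚ.positive⁻¹ 1ℚ

  half+half : ∀ ε → ½ ℚ.* ε ℚ.+ ½ ℚ.* ε ≡ ε
  half+half ε = trans (sym (ℚₚ.*-distribʳ-+ ε ½ ½)) (ℚₚ.*-identityˡ ε)

  *-recip : ∀ p → p ≢ 0ℚ → p ℚ.* recip p ≡ 1ℚ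
  *-recip p@(mkℚ (+ 0)    _ _) p≢0 = ⊥-elim (p≢0 (ℚₚ.↥p≡0⇒p≡0 p refl))
  *-recip p@(mkℚ +[1+ _ ] _ _) _   = ℚₚ.*-inverseʳ p
  *-recip p@(mkℚ -[1+ _ ] _ _) _   = ℚₚ.*-inverseʳ p

  pos≢0 : ∀ {p} → 0ℚ ℚ.< p → p ≢ 0ℚ
  pos≢0 0<p refl = ℚₚ.<-irrefl refl 0<p

  recip-pos : ∀ {p} → 0ℚ ℚ.< p → 0ℚ ℚ.< recip p
  recip-pos {p@(mkℚ +[1+ _ ] _ _)} _ = ℚₚ.positive⁻¹ (ℚ.1/ p)
  recip-pos {mkℚ (+ 0)    _ _} (ℚ.*<* (ℤ.+<+ ()))
  recip-pos {mkℚ -[1+ _ ] _ _} (ℚ.*<* ())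

  abs≢0 : ∀ {δ p} → 0ℚ ℚ.< δ → δ ℚ.≤ ℚ.∣ p ∣ → p ≢ 0ℚ
  abs≢0 0<δ δ≤ refl = ℚₚ.<-irrefl refl (ℚₚ.<-≤-trans 0<δ δ≤)

  ∣p∣*∣recip∣ : ∀ {p} → p ≢ 0ℚ → ℚ.∣ p ∣ ℚ.* ℚ.∣ recip p ∣ ≡ 1ℚ
  ∣p∣*∣recip∣ {p} p≢0 = trans (sym (ℚₚ.∣p*q∣≡∣p∣*∣q∣ p (recip p))) (cong ℚ.∣_∣ (*-recip p p≢0))

  ∣recip∣≤ : ∀ {δ p} → 0ℚ ℚ.< δ → δ ℚ.≤ ℚ.∣ p ∣ → ℚ.∣ recip p ∣ ℚ.≤ recip δ
  ∣recip∣≤ {δ} {p} 0<δ δ≤ = begin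
    r                            ≡⟨ sym (ℚₚ.*-identityˡ r) ⟩
    1ℚ ℚ.* r                     ≡⟨ cong (ℚ._* r) (sym (*-recip δ (pos≢0 0<δ))) ⟩
    δ ℚ.* recip δ ℚ.* r          ≡⟨ solve 3 (λ a b c → a :* b :* c := b :* (a :* c)) refl δ (recip δ) r ⟩
    recip δ ℚ.* (δ ℚ.* r)        ≤⟨ *-monoˡ (0≤ (recip-pos 0<δ)) (*-monoʳ (ℚₚ.0≤∣p∣ (recip p)) δ≤) ⟩
    recip δ ℚ.* (ℚ.∣ p ∣ ℚ.* r)  ≡⟨ cong (recip δ ℚ.*_) (∣p∣*∣recip∣ (abs≢0 0<δ δ≤)) ⟩
    recip δ ℚ.* 1ℚ               ≡⟨ ℚₚ.*-identityʳ _ ⟩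
    recip δ                      ∎
    where open +-*-Solver
          r = ℚ.∣ recip p ∣

  recip≤∣recip∣ : ∀ {B p} → 0ℚ ℚ.< B → p ≢ 0ℚ → ℚ.∣ p ∣ ℚ.≤ B → recip B ℚ.≤ ℚ.∣ recip p ∣
  recip≤∣recip∣ {B} {p} 0<B p≢0 ≤B = begin
    recip B                      ≡⟨ sym (ℚₚ.*-identityʳ _) ⟩
    recip B ℚ.* 1ℚ               ≡⟨ cong (recip B ℚ.*_) (sym (∣p∣*∣recip∣ p≢0)) ⟩
    recip B ℚ.* (ℚ.∣ p ∣ ℚ.* r)  ≤⟨ *-monoˡ (0≤ (recip-pos 0<B)) (*-monoʳ (ℚₚ.0≤∣p∣ (recip p)) ≤B) ⟩
    recip B ℚ.* (B ℚ.* r)        ≡⟨ solve 3 (λ a b c → b :* (a :* c) := a :* b :* c) refl B (recip B) r ⟩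
    B ℚ.* recip B ℚ.* r          ≡⟨ cong (ℚ._* r) (*-recip B (pos≢0 0<B)) ⟩
    1ℚ ℚ.* r                     ≡⟨ ℚₚ.*-identityˡ r ⟩
    r                            ∎
    where open +-*-Solver
          r = ℚ.∣ recip p ∣

  -- It suffices to bound the differences by a fixed multiple of δ.
  cauchy-scaled : ∀ {s} K → 0ℚ ℚ.< K →
    (∀ δ → 0ℚ ℚ.< δ → ∃[ N ] (∀ m n → N ℕ.≤ m → N ℕ.≤ n → ℚ.∣ s m ℚ.- s n ∣ ℚ.≤ K ℚ.* δ)) →
    Cauchy s
  cauchy-scaled {s} K 0<K h ε 0<ε with N , b ← h (recip K ℚ.* ε) (*-pos (recip-pos 0<K) 0<ε) =
    N , λ m n N≤m N≤n → subst (ℚ.∣ s m ℚ.- s n ∣ ℚ.≤_) eq (b m n N≤m N≤n)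
    where
    eq : K ℚ.* (recip K ℚ.* ε) ≡ ε
    eq = trans (sym (ℚₚ.*-assoc K (recip K) ε))
           (trans (cong (ℚ._* ε) (*-recip K (pos≢0 0<K))) (ℚₚ.*-identityˡ ε))

  p≡q+p-q : ∀ p q → p ≡ q ℚ.+ (p ℚ.- q)
  p≡q+p-q = solve 2 (λ p q → p := q :+ (p :- q)) refl where open +-*-Solver

  bounded : ∀ x → ∃[ B ] (0ℚ ℚ.< B × ∃[ N ] (∀ n → N ℕ.≤ n → ℚ.∣ seq x n ∣ ℚ.≤ B))
  bounded (real s c) with N , b ← c 1ℚ 0<1 =
    ℚ.∣ s N ∣ ℚ.+ 1ℚ , ℚₚ.+-mono-≤-< (ℚₚ.0≤∣p∣ (s N)) 0<1 , N , λ n N≤n → begin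
      ℚ.∣ s n ∣                          ≡⟨ cong ℚ.∣_∣ (p≡q+p-q (s n) (s N)) ⟩
      ℚ.∣ s N ℚ.+ (s n ℚ.- s N) ∣        ≤⟨ ℚₚ.∣p+q∣≤∣p∣+∣q∣ (s N) _ ⟩
      ℚ.∣ s N ∣ ℚ.+ ℚ.∣ s n ℚ.- s N ∣    ≤⟨ ℚₚ.+-monoʳ-≤ ℚ.∣ s N ∣ (b n N N≤n ℕₚ.≤-refl) ⟩
      ℚ.∣ s N ∣ ℚ.+ 1ℚ                   ∎

  abstract
    const-cauchy : ∀ q → Cauchy (λ _ → q)
    const-cauchy q ε 0<ε =
      0 , λ _ _ _ _ → subst (ℚ._≤ ε) (sym (cong ℚ.∣_∣ (ℚₚ.+-inverseʳ q))) (0≤ 0<ε)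

  abstract
    sub-cauchy : ∀ x y → Cauchy (λ n → seq x n ℚ.- seq y n)
    sub-cauchy (real s c) (real t d) = cauchy-scaled {λ n → s n ℚ.- t n} (1ℚ ℚ.+ 1ℚ) (ℚₚ.positive⁻¹ (1ℚ ℚ.+ 1ℚ)) λ δ 0<δ →
      let M , b = c δ 0<δ
          N , b′ = d δ 0<δ
      in M ℕ.⊔ N , λ m n m≥ n≥ → begin
        ℚ.∣ s m ℚ.- t m ℚ.- (s n ℚ.- t n) ∣
          ≡⟨ cong ℚ.∣_∣ (solve 4 (λ a b c d → a :- b :- (c :- d) := (a :- c) :- (b :- d)) refl (s m) (t m) (s n) (t n)) ⟩
        ℚ.∣ (s m ℚ.- s n) ℚ.- (t m ℚ.- t n) ∣
          ≤⟨ ℚₚ.∣p-q∣≤∣p∣+∣q∣ (s m ℚ.- s n) (t m ℚ.- t n) ⟩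
        ℚ.∣ s m ℚ.- s n ∣ ℚ.+ ℚ.∣ t m ℚ.- t n ∣
          ≤⟨ ℚₚ.+-mono-≤ (b m n (ℕₚ.m⊔n≤o⇒m≤o M N m≥) (ℕₚ.m⊔n≤o⇒m≤o M N n≥))
                         (b′ m n (ℕₚ.m⊔n≤o⇒n≤o M N m≥) (ℕₚ.m⊔n≤o⇒n≤o M N n≥)) ⟩
        δ ℚ.+ δ
          ≡⟨ solve 1 (λ δ → δ :+ δ := (con 1ℚ :+ con 1ℚ) :* δ) refl δ ⟩
        (1ℚ ℚ.+ 1ℚ) ℚ.* δ ∎
      where open +-*-Solver

  ∣∣-step : ∀ p q → ℚ.∣ p ∣ ℚ.- ℚ.∣ q ∣ ℚ.≤ ℚ.∣ p ℚ.- q ∣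
  ∣∣-step p q = begin
    ℚ.∣ p ∣ ℚ.- ℚ.∣ q ∣                        ≡⟨ cong (λ z → ℚ.∣ z ∣ ℚ.- ℚ.∣ q ∣) (p≡q+p-q p q) ⟩
    ℚ.∣ q ℚ.+ (p ℚ.- q) ∣ ℚ.- ℚ.∣ q ∣          ≤⟨ ℚₚ.+-monoˡ-≤ (ℚ.- ℚ.∣ q ∣) (ℚₚ.∣p+q∣≤∣p∣+∣q∣ q (p ℚ.- q)) ⟩
    ℚ.∣ q ∣ ℚ.+ ℚ.∣ p ℚ.- q ∣ ℚ.- ℚ.∣ q ∣      ≡⟨ solve 2 (λ a b → a :+ b :- a := b) refl ℚ.∣ q ∣ ℚ.∣ p ℚ.- q ∣ ⟩
    ℚ.∣ p ℚ.- q ∣                              ∎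
    where open +-*-Solver

  ∣p-q∣-comm : ∀ p q → ℚ.∣ p ℚ.- q ∣ ≡ ℚ.∣ q ℚ.- p ∣
  ∣p-q∣-comm p q = trans (sym (ℚₚ.∣-p∣≡∣p∣ (p ℚ.- q)))
    (cong ℚ.∣_∣ (solve 2 (λ p q → :- (p :- q) := q :- p) refl p q))
    where open +-*-Solver

  ∣∣-≤ : ∀ {p r} → p ℚ.≤ r → ℚ.- p ℚ.≤ r → ℚ.∣ p ∣ ℚ.≤ r
  ∣∣-≤ {p} p≤ -p≤ with ℚₚ.∣p∣≡p∨∣p∣≡-p p
  ... | inj₁ eq = subst (ℚ._≤ _) (sym eq) p≤
  ... | inj₂ eq = subst (ℚ._≤ _) (sym eq) -p≤

  abstract
    abs-cauchy : ∀ x → Cauchy (λ n → ℚ.∣ seq x n ∣)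
    abs-cauchy (real s c) ε 0<ε with N , b ← c ε 0<ε =
      N , λ m n m≥ n≥ → ∣∣-≤
        (ℚₚ.≤-trans (∣∣-step (s m) (s n)) (b m n m≥ n≥))
        (subst (ℚ._≤ ε) (neg-sub ℚ.∣ s m ∣ ℚ.∣ s n ∣)
          (ℚₚ.≤-trans (∣∣-step (s n) (s m)) (b n m n≥ m≥)))
      where
      open +-*-Solver
      neg-sub : ∀ a b → b ℚ.- a ≡ ℚ.- (a ℚ.- b)
      neg-sub = solve 2 (λ a b → b :- a := :- (a :- b)) refl

  ∣p*q∣≤ : ∀ p q {P Q} → 0ℚ ℚ.≤ Q → ℚ.∣ p ∣ ℚ.≤ P → ℚ.∣ q ∣ ℚ.≤ Q → ℚ.∣ p ℚ.* q ∣ ℚ.≤ P ℚ.* Q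
  ∣p*q∣≤ p q {P} {Q} 0≤Q p≤ q≤ = begin
    ℚ.∣ p ℚ.* q ∣          ≡⟨ ℚₚ.∣p*q∣≡∣p∣*∣q∣ p q ⟩
    ℚ.∣ p ∣ ℚ.* ℚ.∣ q ∣    ≤⟨ *-monoˡ (ℚₚ.0≤∣p∣ p) q≤ ⟩
    ℚ.∣ p ∣ ℚ.* Q          ≤⟨ *-monoʳ 0≤Q p≤ ⟩
    P ℚ.* Q                ∎

  ∣ab-cd∣≤ : ∀ a b c d {B C δ} → 0ℚ ℚ.≤ δ → ℚ.∣ a ∣ ℚ.≤ B → ℚ.∣ d ∣ ℚ.≤ C →
    ℚ.∣ a ℚ.- c ∣ ℚ.≤ δ → ℚ.∣ b ℚ.- d ∣ ℚ.≤ δ →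
    ℚ.∣ a ℚ.* b ℚ.- c ℚ.* d ∣ ℚ.≤ (B ℚ.+ C) ℚ.* δ
  ∣ab-cd∣≤ a b c d {B} {C} {δ} 0≤δ a≤ d≤ ac≤ bd≤ = begin
    ℚ.∣ a ℚ.* b ℚ.- c ℚ.* d ∣
      ≡⟨ cong ℚ.∣_∣ (split a b c d) ⟩
    ℚ.∣ a ℚ.* (b ℚ.- d) ℚ.+ d ℚ.* (a ℚ.- c) ∣
      ≤⟨ ℚₚ.∣p+q∣≤∣p∣+∣q∣ (a ℚ.* (b ℚ.- d)) (d ℚ.* (a ℚ.- c)) ⟩
    ℚ.∣ a ℚ.* (b ℚ.- d) ∣ ℚ.+ ℚ.∣ d ℚ.* (a ℚ.- c) ∣
      ≤⟨ ℚₚ.+-mono-≤ (∣p*q∣≤ a (b ℚ.- d) 0≤δ a≤ bd≤) (∣p*q∣≤ d (a ℚ.- c) 0≤δ d≤ ac≤) ⟩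
    B ℚ.* δ ℚ.+ C ℚ.* δ
      ≡⟨ sym (ℚₚ.*-distribʳ-+ δ B C) ⟩
    (B ℚ.+ C) ℚ.* δ ∎
    where
    open +-*-Solver
    split : ∀ a b c d → a ℚ.* b ℚ.- c ℚ.* d ≡ a ℚ.* (b ℚ.- d) ℚ.+ d ℚ.* (a ℚ.- c)
    split = solve 4 (λ a b c d → a :* b :- c :* d := a :* (b :- d) :+ d :* (a :- c)) refl

  abstract
    mul-cauchy : ∀ x y → Cauchy (λ n → seq x n ℚ.* seq y n)
    mul-cauchy x y =
      let B , 0<B , M₁ , bx = bounded x
          C , 0<C , M₂ , by = bounded y
      in cauchy-scaled {λ n → seq x n ℚ.* seq y n} (B ℚ.+ C) (ℚₚ.+-mono-< 0<B 0<C) λ δ 0<δ →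
        let N₁ , cx = cauchy x δ 0<δ
            N₂ , cy = cauchy y δ 0<δ
            M = M₁ ℕ.⊔ M₂
            N = N₁ ℕ.⊔ N₂
        in M ℕ.⊔ N , λ m n m≥ n≥ →
          let m≥M = ℕₚ.m⊔n≤o⇒m≤o M N m≥
              n≥M = ℕₚ.m⊔n≤o⇒m≤o M N n≥
              m≥N = ℕₚ.m⊔n≤o⇒n≤o M N m≥
              n≥N = ℕₚ.m⊔n≤o⇒n≤o M N n≥
          in ∣ab-cd∣≤ (seq x m) (seq y m) (seq x n) (seq y n) (0≤ 0<δ)
               (bx m (ℕₚ.m⊔n≤o⇒m≤o M₁ M₂ m≥M))
               (by n (ℕₚ.m⊔n≤o⇒n≤o M₁ M₂ n≥M))
               (cx m n (ℕₚ.m⊔n≤o⇒m≤o N₁ N₂ m≥N) (ℕₚ.m⊔n≤o⇒m≤o N₁ N₂ n≥N))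
               (cy m n (ℕₚ.m⊔n≤o⇒n≤o N₁ N₂ m≥N) (ℕₚ.m⊔n≤o⇒n≤o N₁ N₂ n≥N))

  abstract
    inv-cauchy : ∀ x {δ} → 0ℚ ℚ.< δ → ∃[ N ] (∀ n → N ℕ.≤ n → 0ℚ ℚ.+ δ ℚ.≤ ℚ.∣ seq x n ∣) →
      Cauchy (λ n → recip (seq x n))
    inv-cauchy (real s c) {δ} 0<δ (M , away) =
      cauchy-scaled {λ n → recip (s n)} (recip δ ℚ.* recip δ) (*-pos 0<r 0<r) λ η 0<η →
      let N , b = c η 0<η
          toM : ∀ k → M ℕ.⊔ N ℕ.≤ k → M ℕ.≤ k
          toM = λ k → ℕₚ.m⊔n≤o⇒m≤o M N
          toN : ∀ k → M ℕ.⊔ N ℕ.≤ k → N ℕ.≤ k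
          toN = λ k → ℕₚ.m⊔n≤o⇒n≤o M N
      in M ℕ.⊔ N , λ m n m≥ n≥ → begin
        ℚ.∣ recip (s m) ℚ.- recip (s n) ∣
          ≡⟨ cong ℚ.∣_∣ (difference (s m) (s n) (abs≢0 0<δ (away′ m (toM m m≥))) (abs≢0 0<δ (away′ n (toM n n≥)))) ⟩
        ℚ.∣ recip (s m) ℚ.* recip (s n) ℚ.* (s n ℚ.- s m) ∣
          ≡⟨ ℚₚ.∣p*q∣≡∣p∣*∣q∣ (recip (s m) ℚ.* recip (s n)) (s n ℚ.- s m) ⟩
        ℚ.∣ recip (s m) ℚ.* recip (s n) ∣ ℚ.* ℚ.∣ s n ℚ.- s m ∣
          ≡⟨ cong (ℚ._* ℚ.∣ s n ℚ.- s m ∣) (ℚₚ.∣p*q∣≡∣p∣*∣q∣ (recip (s m)) (recip (s n))) ⟩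
        ℚ.∣ recip (s m) ∣ ℚ.* ℚ.∣ recip (s n) ∣ ℚ.* ℚ.∣ s n ℚ.- s m ∣
          ≤⟨ *-monoʳ (ℚₚ.0≤∣p∣ (s n ℚ.- s m)) (ℚₚ.≤-trans
               (*-monoˡ (ℚₚ.0≤∣p∣ (recip (s m))) (∣recip∣≤ 0<δ (away′ n (toM n n≥))))
               (*-monoʳ (0≤ 0<r) (∣recip∣≤ 0<δ (away′ m (toM m m≥))))) ⟩
        recip δ ℚ.* recip δ ℚ.* ℚ.∣ s n ℚ.- s m ∣
          ≤⟨ *-monoˡ (0≤ (*-pos 0<r 0<r)) (b n m (toN n n≥) (toN m m≥)) ⟩
        recip δ ℚ.* recip δ ℚ.* η ∎
      where
      open +-*-Solver
      0<r : 0ℚ ℚ.< recip δ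
      0<r = recip-pos 0<δ
      away′ : ∀ n → M ℕ.≤ n → δ ℚ.≤ ℚ.∣ s n ∣
      away′ n M≤n = subst (ℚ._≤ ℚ.∣ s n ∣) (ℚₚ.+-identityˡ δ) (away n M≤n)
      difference : ∀ p q → p ≢ 0ℚ → q ≢ 0ℚ → recip p ℚ.- recip q ≡ recip p ℚ.* recip q ℚ.* (q ℚ.- p)
      difference p q p≢0 q≢0 = begin-equality
        recip p ℚ.- recip q
          ≡⟨ solve 2 (λ a b → a :- b := a :* con 1ℚ :- b :* con 1ℚ) refl (recip p) (recip q) ⟩
        recip p ℚ.* 1ℚ ℚ.- recip q ℚ.* 1ℚ
          ≡⟨ cong₂ (λ u v → recip p ℚ.* u ℚ.- recip q ℚ.* v) (sym (*-recip q q≢0)) (sym (*-recip p p≢0)) ⟩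
        recip p ℚ.* (q ℚ.* recip q) ℚ.- recip q ℚ.* (p ℚ.* recip p)
          ≡⟨ solve 4 (λ p q a b → a :* (q :* b) :- b :* (p :* a) := a :* b :* (q :- p)) refl p q (recip p) (recip q) ⟩
        recip p ℚ.* recip q ℚ.* (q ℚ.- p) ∎

  1/!_ : ℕ → ℚ
  1/! n = (+ 1 ℚ./ n !) {{n ℕₚ.!≢0}}

  1/-pos : ∀ n .{{_ : ℕ.NonZero n}} → 0ℚ ℚ.< + 1 ℚ./ n
  1/-pos n = ℚₚ.positive⁻¹ _ {{ℚₚ.normalize-pos 1 n}}

  1/-anti : ∀ m n .{{_ : ℕ.NonZero m}} .{{_ : ℕ.NonZero n}} → m ℕ.≤ n → + 1 ℚ./ n ℚ.≤ + 1 ℚ./ m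
  1/-anti (suc m) (suc n) m≤n = ℚₚ.toℚᵘ-cancel-≤
    (ℚᵘₚ.≤-respˡ-≃ (ℚᵘₚ.≃-sym (ℚₚ.toℚᵘ-fromℚᵘ (ℚᵘ.mkℚᵘ (+ 1) n)))
    (ℚᵘₚ.≤-respʳ-≃ (ℚᵘₚ.≃-sym (ℚₚ.toℚᵘ-fromℚᵘ (ℚᵘ.mkℚᵘ (+ 1) m)))
    (ℚᵘ.*≤* (ℤₚ.*-monoˡ-≤-nonNeg (+ 1) (ℤ.+≤+ m≤n)))))

  1/-* : ∀ m n .{{_ : ℕ.NonZero m}} .{{_ : ℕ.NonZero n}} .{{_ : ℕ.NonZero (m ℕ.* n)}} →
    + 1 ℚ./ (m ℕ.* n) ≡ (+ 1 ℚ./ m) ℚ.* (+ 1 ℚ./ n)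
  1/-* (suc m) (suc n) = ℚₚ.toℚᵘ-injective (ℚᵘₚ.≃-trans
    (ℚₚ.toℚᵘ-fromℚᵘ (ℚᵘ.mkℚᵘ (+ 1) (n ℕ.+ m ℕ.* suc n)))
    (ℚᵘₚ.≃-sym (ℚᵘₚ.≃-trans (ℚₚ.toℚᵘ-homo-* (+ 1 ℚ./ suc m) (+ 1 ℚ./ suc n))
      (ℚᵘₚ.*-cong (ℚₚ.toℚᵘ-fromℚᵘ (ℚᵘ.mkℚᵘ (+ 1) m)) (ℚₚ.toℚᵘ-fromℚᵘ (ℚᵘ.mkℚᵘ (+ 1) n))))))

  1/!-pos : ∀ n → 0ℚ ℚ.< 1/! n
  1/!-pos n = 1/-pos (n !) {{n ℕₚ.!≢0}}

  1/!≤1 : ∀ n → 1/! n ℚ.≤ 1ℚ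
  1/!≤1 n = 1/-anti 1 (n !) {{_}} {{n ℕₚ.!≢0}} (ℕₚ.1≤n! n)

  1/!-suc : ∀ n → 1/! (suc n) ≡ (+ 1 ℚ./ suc n) ℚ.* 1/! n
  1/!-suc n = 1/-* (suc n) (n !) {{_}} {{n ℕₚ.!≢0}} {{suc n ℕₚ.!≢0}}

  1/!-half : ∀ n → 1 ℕ.≤ n → 1/! (suc n) ℚ.≤ ½ ℚ.* 1/! n
  1/!-half n 1≤n = begin
    1/! (suc n)                  ≡⟨ 1/!-suc n ⟩
    (+ 1 ℚ./ suc n) ℚ.* 1/! n    ≤⟨ *-monoʳ (0≤ (1/!-pos n)) (1/-anti 2 (suc n) (s≤s 1≤n)) ⟩
    ½ ℚ.* 1/! n                  ∎

  1/!-small : ∀ n → 1/! (suc n) ℚ.≤ + 1 ℚ./ suc n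
  1/!-small n = begin
    1/! (suc n)                  ≡⟨ 1/!-suc n ⟩
    (+ 1 ℚ./ suc n) ℚ.* 1/! n    ≤⟨ *-monoˡ (0≤ (1/-pos (suc n))) (1/!≤1 n) ⟩
    (+ 1 ℚ./ suc n) ℚ.* 1ℚ       ≡⟨ ℚₚ.*-identityʳ _ ⟩
    + 1 ℚ./ suc n                ∎

  archimedean : ∀ ε → 0ℚ ℚ.< ε → ∃[ N ] (+ 1 ℚ./ suc N ℚ.≤ ε)
  archimedean (mkℚ (+ 0)    _ _) (ℚ.*<* (ℤ.+<+ ()))
  archimedean (mkℚ -[1+ _ ] _ _) (ℚ.*<* ())
  archimedean (mkℚ +[1+ a ] d _) _ = d , ℚₚ.toℚᵘ-cancel-≤ (ℚᵘₚ.≤-respˡ-≃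
    (ℚᵘₚ.≃-sym (ℚₚ.toℚᵘ-fromℚᵘ (ℚᵘ.mkℚᵘ (+ 1) d)))
    (ℚᵘ.*≤* (ℤₚ.*-monoʳ-≤-nonNeg (+ suc d) {+ 1} {+[1+ a ]} (ℤ.+≤+ (s≤s z≤n)))))

  Σ-mono : ∀ {m n} → m ℕ.≤′ n → Σ1/k! m ℚ.≤ Σ1/k! n
  Σ-mono (ℕ.≤′-reflexive refl) = ℚₚ.≤-refl
  Σ-mono {m} (ℕ.≤′-step {n} m≤n) = begin
    Σ1/k! m               ≤⟨ Σ-mono m≤n ⟩
    Σ1/k! n               ≡⟨ sym (ℚₚ.+-identityʳ _) ⟩
    Σ1/k! n ℚ.+ 0ℚ        ≤⟨ ℚₚ.+-monoʳ-≤ (Σ1/k! n) (0≤ (1/!-pos n)) ⟩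
    Σ1/k! (suc n)         ∎

  upper : ℕ → ℚ
  upper n = Σ1/k! n ℚ.+ (1/! n ℚ.+ 1/! n)

  upper-anti : ∀ {m n} → 1 ℕ.≤ m → m ℕ.≤′ n → upper n ℚ.≤ upper m
  upper-anti 1≤m (ℕ.≤′-reflexive refl) = ℚₚ.≤-refl
  upper-anti {m} 1≤m (ℕ.≤′-step {n} m≤n) = begin
    Σ1/k! n ℚ.+ f ℚ.+ (f′ ℚ.+ f′)          ≤⟨ ℚₚ.+-monoʳ-≤ (Σ1/k! n ℚ.+ f) (ℚₚ.+-mono-≤ h h) ⟩
    Σ1/k! n ℚ.+ f ℚ.+ (½ ℚ.* f ℚ.+ ½ ℚ.* f)  ≡⟨ cong (Σ1/k! n ℚ.+ f ℚ.+_) (half+half f) ⟩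
    Σ1/k! n ℚ.+ f ℚ.+ f                    ≡⟨ ℚₚ.+-assoc (Σ1/k! n) f f ⟩
    upper n                                ≤⟨ upper-anti 1≤m m≤n ⟩
    upper m                                ∎
    where
    f = 1/! n
    f′ = 1/! (suc n)
    h = 1/!-half n (ℕₚ.≤-trans 1≤m (ℕₚ.≤′⇒≤ m≤n))

  Σ-diff : ∀ {m n} → 1 ℕ.≤ m → m ℕ.≤ n → ℚ.∣ Σ1/k! n ℚ.- Σ1/k! m ∣ ℚ.≤ 1/! m ℚ.+ 1/! m
  Σ-diff {m} {n} 1≤m m≤n = begin
    ℚ.∣ Σ1/k! n ℚ.- Σ1/k! m ∣      ≡⟨ ℚₚ.0≤p⇒∣p∣≡p (subst (ℚ._≤ Σ1/k! n ℚ.- Σ1/k! m) (ℚₚ.+-inverseʳ (Σ1/k! m))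
                                        (ℚₚ.+-monoˡ-≤ (ℚ.- Σ1/k! m) (Σ-mono (ℕₚ.≤⇒≤′ m≤n)))) ⟩
    Σ1/k! n ℚ.- Σ1/k! m            ≤⟨ ℚₚ.+-monoˡ-≤ (ℚ.- Σ1/k! m) Σ≤upper ⟩
    upper m ℚ.- Σ1/k! m            ≡⟨ solve 2 (λ a b → a :+ b :- a := b) refl (Σ1/k! m) (1/! m ℚ.+ 1/! m) ⟩
    1/! m ℚ.+ 1/! m                ∎
    where
    open +-*-Solver
    Σ≤upper : Σ1/k! n ℚ.≤ upper m
    Σ≤upper = begin
      Σ1/k! n          ≡⟨ sym (ℚₚ.+-identityʳ _) ⟩
      Σ1/k! n ℚ.+ 0ℚ   ≤⟨ ℚₚ.+-monoʳ-≤ (Σ1/k! n) (0≤ (ℚₚ.+-mono-< (1/!-pos n) (1/!-pos n))) ⟩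
      upper n          ≤⟨ upper-anti 1≤m (ℕₚ.≤⇒≤′ m≤n) ⟩
      upper m          ∎

  abstract
    Σ1/k!-cauchy : Cauchy Σ1/k!
    Σ1/k!-cauchy ε 0<ε with N , small ← archimedean (½ ℚ.* ε) (*-pos 0<½ 0<ε) = suc N , close
      where
      ordered : ∀ m n → suc N ℕ.≤ m → m ℕ.≤ n → ℚ.∣ Σ1/k! n ℚ.- Σ1/k! m ∣ ℚ.≤ ε
      ordered (suc m) n N≤m m≤n = begin
        ℚ.∣ Σ1/k! n ℚ.- Σ1/k! (suc m) ∣     ≤⟨ Σ-diff (s≤s z≤n) m≤n ⟩
        1/! (suc m) ℚ.+ 1/! (suc m)         ≤⟨ ℚₚ.+-mono-≤ h h ⟩
        ½ ℚ.* ε ℚ.+ ½ ℚ.* ε                 ≡⟨ half+half ε ⟩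
        ε                                   ∎
        where
        h : 1/! (suc m) ℚ.≤ ½ ℚ.* ε
        h = ℚₚ.≤-trans (1/!-small m) (ℚₚ.≤-trans (1/-anti (suc N) (suc m) N≤m) small)
      close : ∀ m n → suc N ℕ.≤ m → suc N ℕ.≤ n → ℚ.∣ Σ1/k! m ℚ.- Σ1/k! n ∣ ℚ.≤ ε
      close m n N≤m N≤n with ℕₚ.≤-total m n
      ... | inj₁ m≤n = subst (ℚ._≤ ε) (∣p-q∣-comm (Σ1/k! n) (Σ1/k! m)) (ordered m n N≤m m≤n)
      ... | inj₂ n≤m = ordered n m N≤n n≤m

open CauchyLemmas

fromℚ : ℚ → ℝ
fromℚ q = real (λ _ → q) (const-cauchy q)

fromℕ : ℕ → ℝ
fromℕ n = fromℚ (+ n ℚ./ 1)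

0ℝ 1ℝ : ℝ
0ℝ = fromℚ 0ℚ
1ℝ = fromℚ 1ℚ

infixl 6 _-_
infixl 7 _*_ _÷_
infixr 8 _^_

_-_ : ℝ → ℝ → ℝ
x - y = real (λ n → seq x n ℚ.- seq y n) (sub-cauchy x y)

_*_ : ℝ → ℝ → ℝ
x * y = real (λ n → seq x n ℚ.* seq y n) (mul-cauchy x y)

_^_ : ℝ → ℕ → ℝ
x ^ zero  = 1ℝ
x ^ suc k = x * x ^ k

∣_∣ : ℝ → ℝ
∣ x ∣ = real (λ n → ℚ.∣ seq x n ∣) (abs-cauchy x)

-- Constructive form of x ≠ 0: the sequence is eventually bounded away from 0.
record NonZero (x : ℝ) : Set where
  constructor nonZero
  field
    0<∣x∣ : 0ℝ < ∣ x ∣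

_÷_ : (x y : ℝ) → {{NonZero y}} → ℝ
_÷_ x y {{nonZero (δ , 0<δ , away)}} =
  x * real (λ n → recip (seq y n)) (inv-cauchy y 0<δ away)

e : ℝ
e = real Σ1/k! Σ1/k!-cauchy

1-nonZero : NonZero 1ℝ
1-nonZero = nonZero (1ℚ , 0<1 , 0 , λ _ _ → ℚₚ.≤-refl)

*-nonZero : ∀ {x y} → NonZero x → NonZero y → NonZero (x * y)
*-nonZero {x} {y} (nonZero (δ , 0<δ , M , a)) (nonZero (η , 0<η , N , b)) =
  nonZero (δ ℚ.* η , *-pos 0<δ 0<η , M ℕ.⊔ N , λ n n≥ → begin
    0ℚ ℚ.+ δ ℚ.* η                 ≡⟨ ℚₚ.+-identityˡ _ ⟩
    δ ℚ.* η                        ≤⟨ *-monoˡ (0≤ 0<δ) (drop0 {η} {ℚ.∣ seq y n ∣} (b n (ℕₚ.m⊔n≤o⇒n≤o M N n≥))) ⟩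
    δ ℚ.* ℚ.∣ seq y n ∣            ≤⟨ *-monoʳ (ℚₚ.0≤∣p∣ (seq y n)) (drop0 {δ} {ℚ.∣ seq x n ∣} (a n (ℕₚ.m⊔n≤o⇒m≤o M N n≥))) ⟩
    ℚ.∣ seq x n ∣ ℚ.* ℚ.∣ seq y n ∣ ≡⟨ sym (ℚₚ.∣p*q∣≡∣p∣*∣q∣ (seq x n) (seq y n)) ⟩
    ℚ.∣ seq x n ℚ.* seq y n ∣      ∎)
  where
  drop0 : ∀ {p q} → 0ℚ ℚ.+ p ℚ.≤ q → p ℚ.≤ q
  drop0 {p} = subst (ℚ._≤ _) (ℚₚ.+-identityˡ p)

^-nonZero : ∀ {x} k → NonZero x → NonZero (x ^ k)
^-nonZero zero    _   = 1-nonZero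
^-nonZero (suc k) x≠0 = *-nonZero x≠0 (^-nonZero k x≠0)

÷-nonZero : ∀ {x y} → NonZero x → {{y≠0 : NonZero y}} → NonZero (x ÷ y)
÷-nonZero {x} {y} x≠0 {{nonZero (δ , 0<δ , M , a)}} =
  let B , 0<B , N , b = bounded y
  in *-nonZero x≠0 (nonZero (recip B , recip-pos 0<B , M ℕ.⊔ N , λ n n≥ →
    subst (ℚ._≤ ℚ.∣ recip (seq y n) ∣) (sym (ℚₚ.+-identityˡ (recip B)))
      (recip≤∣recip∣ 0<B
        (abs≢0 0<δ (subst (ℚ._≤ ℚ.∣ seq y n ∣) (ℚₚ.+-identityˡ δ) (a n (ℕₚ.m⊔n≤o⇒m≤o M N n≥))))
        (b n (ℕₚ.m⊔n≤o⇒n≤o M N n≥)))))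

fromℕ-nonZero : ∀ n → .{{ℕ.NonZero n}} → NonZero (fromℕ n)
fromℕ-nonZero n = nonZero
  (+ n ℚ./ 1 , 0<n , 0 , λ _ _ → ℚₚ.≤-reflexive (trans (ℚₚ.+-identityˡ _) (sym (ℚₚ.0≤p⇒∣p∣≡p (0≤ 0<n)))))
  where
  0<n : 0ℚ ℚ.< + n ℚ./ 1
  0<n = ℚₚ.positive⁻¹ _ {{ℚₚ.normalize-pos n 1}}

e-nonZero : NonZero e
e-nonZero = nonZero (1ℚ , 0<1 , 1 , λ n 1≤n →
  subst (1ℚ ℚ.≤_) (sym (ℚₚ.0≤p⇒∣p∣≡p (ℚₚ.≤-trans (0≤ 0<1) (Σ-mono (ℕₚ.≤⇒≤′ 1≤n))))) (Σ-mono (ℕₚ.≤⇒≤′ 1≤n)))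

instance
  e⁴-nonZero : NonZero (e ^ 4)
  e⁴-nonZero = ^-nonZero 4 e-nonZero

Sequence : Set
Sequence = (n : ℕ) → .{{ℕ.NonZero n}} → ℝ

infix 4 _⟶_ _∼_

_⟶_ : Sequence → ℝ → Set
a ⟶ L = ∀ ε → 0ℝ < ε → ∃[ N ] (∀ n .{{_ : ℕ.NonZero n}} → N ℕ.≤ n → ∣ a n - L ∣ < ε)

_∼_ : Sequence → Sequence → Set
a ∼ b = Σ (∀ n .{{_ : ℕ.NonZero n}} → NonZero (b n)) λ b≠0 →
  (λ n → _÷_ (a n) (b n) {{b≠0 n}}) ⟶ 1ℝ

{-# OPTIONS --safe #-}

-- A space at distance r from the border is occupied or attacked from exactly
-- a = 3n − 2 + 2r spaces, so it is safe with probability C(n² − a, n) / C(n², n),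
-- a product of a factors, each between 1 − 1/(n − 4) and 1 − 1/n. For q = 1 − 1/m
-- with m = n or m = n − 4, the sum of q^a over the board is q^(3n − 2) times the
-- sum of (q²)^r, which satisfies a recursion in n obtained by stripping the border
-- off the board and is 2 n² qⁿ to first order. As qᵐ tends to 1/e, both bounds are
-- 2 n² / e⁴ up to a relative error of order 1/n.

module Submission where

-- The real `e` is available only through its partial sums, so no estimate can mention its value.
-- Each bound is therefore a rational inequality with `Σ1/k! k` in place of `e`, valid for every
-- `k ≥ n`, and its error `54 / (n − 4)` does not depend on `k`. This is enough because inequalities
-- between reals only concern the tails of their sequences. The comparison of `(1 − 1/m) ^ m` with
-- `1/e` uses neither logarithms nor limits: a Taylor polynomial is followed from 0 to 1 in equal
-- small steps, each of which multiplies it by a controlled factor. The shift from `n` to `n − 4`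
-- comes from the ratio of consecutive binomials, `(M C n) / (suc M C n) = 1 − n / (M + 1)`.
-- Removing the spaces that attack a given one lowers `M + 1` from `n²`, but a space is attacked
-- from at most `4 n` spaces, so `M + 1` stays above `n (n − 4)`.

-- Exact counting: the total number of safe spaces as a sum of binomial coefficients.

module Counting where

  open import Data.Bool using (true; false; if_then_else_)
  open import Data.Empty using (⊥)
  open import Data.Fin using (Fin; zero; suc; toℕ; combine; remQuot; _↑ˡ_; _↑ʳ_)
  open import Data.Fin.Properties using (all?; toℕ<n; toℕ-inject₁; toℕ-fromℕ; toℕ-injective; combine-remQuot; remQuot-combine)
  open import Data.Fin.Subset using (Subset; inside; outside; _∈_) renaming (∣_∣ to size)
  open import Data.Fin.Subset.Properties using (_∈?_)
  open import Data.List using (List; []; _∷_; _++_; map; filter; length; allFin; cartesianProduct; tabulate)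
  open import Data.List.Properties using (filter-++; length-++; filter-≐; filter-none; map-++; map-tabulate; map-cong; map-∘)
  open import Data.List.Relation.Unary.All using (universal)
  open import Data.Nat
  open import Data.Nat.Combinatorics using (_C_; nCk+nC[k+1]≡[n+1]C[k+1])
  open import Data.Nat.ListAction using () renaming (sum to sumᴸ)
  open import Data.Nat.ListAction.Properties using () renaming (sum-++ to sumᴸ-++)
  open import Data.Nat.Properties
  open import Data.Nat.Solver using (module +-*-Solver)
  open import Data.Product using (_×_; _,_; proj₁; proj₂; uncurry; map₂)
  open import Data.Sum using (_⊎_; inj₁; inj₂)
  open import Data.Vec using ([]; _∷_; here; there)
  open import Function using (_∘_; _⇔_; mk⇔)
  open import Relation.Binary.PropositionalEquality using (_≡_; refl; sym; trans; cong; cong₂; subst; module ≡-Reasoning)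
  open import Relation.Nullary using (¬_; Dec; yes; no; does; ¬?)
  open import Relation.Nullary.Decidable using (_×-dec_; _⊎-dec_; _→-dec_; does-⇔)
  open import Relation.Unary using (Decidable; _≐_)

  open import Defs using (Space; Attacks; Safe; attacks?; safe?; safeCount; allSubsets; placements)
  open import Algebra.Properties.Semiring.Sum +-*-semiring
  open +-*-Solver using (solve; _:+_; _:*_; _:=_; con)

  ⟦_⟧ : ∀ {A : Set} → Dec A → ℕ
  ⟦ a? ⟧ = if does a? then 1 else 0

  ⟦⟧-cong : ∀ {A B : Set} → A ⇔ B → (a? : Dec A) (b? : Dec B) → ⟦ a? ⟧ ≡ ⟦ b? ⟧
  ⟦⟧-cong A⇔B a? b? = cong (if_then 1 else 0) (does-⇔ A⇔B a? b?)

  ⟦¬⟧+⟦⟧ : ∀ {A : Set} (a? : Dec A) → ⟦ ¬? a? ⟧ + ⟦ a? ⟧ ≡ 1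
  ⟦¬⟧+⟦⟧ a? with does a?
  ... | true  = refl
  ... | false = refl

  length-filter-∷ : ∀ {A : Set} {P : A → Set} (P? : Decidable P) x xs →
    length (filter P? (x ∷ xs)) ≡ ⟦ P? x ⟧ + length (filter P? xs)
  length-filter-∷ P? x xs with does (P? x)
  ... | true  = refl
  ... | false = refl

  length-filter-map : ∀ {A B : Set} {P : A → Set} (P? : Decidable P) (f : B → A) xs →
    length (filter P? (map f xs)) ≡ length (filter (P? ∘ f) xs)
  length-filter-map P? f []       = refl
  length-filter-map P? f (x ∷ xs) = begin
    length (filter P? (f x ∷ map f xs))           ≡⟨ length-filter-∷ P? (f x) (map f xs) ⟩
    ⟦ P? (f x) ⟧ + length (filter P? (map f xs))  ≡⟨ cong (⟦ P? (f x) ⟧ +_) (length-filter-map P? f xs) ⟩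
    ⟦ P? (f x) ⟧ + length (filter (P? ∘ f) xs)    ≡⟨ length-filter-∷ (P? ∘ f) x xs ⟨
    length (filter (P? ∘ f) (x ∷ xs))             ∎
    where open ≡-Reasoning

  filter-filter : ∀ {A : Set} {P Q : A → Set} (P? : Decidable P) (Q? : Decidable Q) xs →
    filter P? (filter Q? xs) ≡ filter (λ x → Q? x ×-dec P? x) xs
  filter-filter P? Q? [] = refl
  filter-filter P? Q? (x ∷ xs) with does (Q? x)
  ... | false = filter-filter P? Q? xs
  ... | true with does (P? x)
  ...   | true  = cong (x ∷_) (filter-filter P? Q? xs)
  ...   | false = filter-filter P? Q? xs

  sum-map-+ : ∀ {A : Set} (f g : A → ℕ) xs →
    sumᴸ (map (λ x → f x + g x) xs) ≡ sumᴸ (map f xs) + sumᴸ (map g xs)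
  sum-map-+ f g []       = refl
  sum-map-+ f g (x ∷ xs) = begin
    f x + g x + sumᴸ (map (λ x → f x + g x) xs)          ≡⟨ cong (f x + g x +_) (sum-map-+ f g xs) ⟩
    f x + g x + (sumᴸ (map f xs) + sumᴸ (map g xs))      ≡⟨ +-assoc-middle (f x) (g x) _ _ ⟩
    f x + sumᴸ (map f xs) + (g x + sumᴸ (map g xs))      ∎
    where
    open ≡-Reasoning
    +-assoc-middle : ∀ a b c d → a + b + (c + d) ≡ a + c + (b + d)
    +-assoc-middle = solve 4 (λ a b c d → a :+ b :+ (c :+ d) := a :+ c :+ (b :+ d)) refl

  length-filter≡sum : ∀ {A : Set} {P : A → Set} (P? : Decidable P) xs →
    length (filter P? xs) ≡ sumᴸ (map (⟦_⟧ ∘ P?) xs)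
  length-filter≡sum P? []       = refl
  length-filter≡sum P? (x ∷ xs) =
    trans (length-filter-∷ P? x xs) (cong (⟦ P? x ⟧ +_) (length-filter≡sum P? xs))

  -- Applied to safety this is linearity of expectation: the safe spaces of all placements are
  -- counted space by space.
  double-counting : ∀ {A B : Set} {R : A → B → Set} (R? : ∀ x y → Dec (R x y)) xs ys →
    sumᴸ (map (λ x → length (filter (R? x) ys)) xs) ≡
    sumᴸ (map (λ y → length (filter (λ x → R? x y) xs)) ys)
  double-counting R? [] ys = sym (sum-map-0 ys)
    where
    sum-map-0 : ∀ {A : Set} (xs : List A) → sumᴸ (map (λ _ → 0) xs) ≡ 0
    sum-map-0 []       = refl
    sum-map-0 (_ ∷ xs) = sum-map-0 xs
  double-counting R? (x ∷ xs) ys = begin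
    length (filter (R? x) ys) + sumᴸ (map (λ x → length (filter (R? x) ys)) xs)
      ≡⟨ cong₂ _+_ (length-filter≡sum (R? x) ys) (double-counting R? xs ys) ⟩
    sumᴸ (map (⟦_⟧ ∘ R? x) ys) + sumᴸ (map (λ y → length (filter (λ x → R? x y) xs)) ys)
      ≡⟨ sum-map-+ (⟦_⟧ ∘ R? x) (λ y → length (filter (λ x → R? x y) xs)) ys ⟨
    sumᴸ (map (λ y → ⟦ R? x y ⟧ + length (filter (λ x → R? x y) xs)) ys)
      ≡⟨ cong sumᴸ (map-cong (λ y → length-filter-∷ (λ x → R? x y) x xs) ys) ⟨
    sumᴸ (map (λ y → length (filter (λ x → R? x y) (x ∷ xs))) ys) ∎
    where open ≡-Reasoning

  -- Subsets of a given size that avoid a forbidden set.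

  Avoids : ∀ {N} → (Fin N → Set) → Subset N → Set
  Avoids P p = ∀ i → i ∈ p → ¬ P i

  avoids? : ∀ {N} {P : Fin N → Set} → Decidable P → Decidable (Avoids P)
  avoids? P? p = all? λ i → (i ∈? p) →-dec ¬? (P? i)

  module _ {N} {P : Fin (suc N) → Set} {p : Subset N} where

    avoids-outside : Avoids P (outside ∷ p) ⇔ Avoids (P ∘ suc) p
    avoids-outside = mk⇔ (λ a i i∈p → a (suc i) (there i∈p))
      λ { a (suc i) (there i∈p) → a i i∈p }

    avoids-inside : ¬ P zero → Avoids P (inside ∷ p) ⇔ Avoids (P ∘ suc) p
    avoids-inside ¬P0 = mk⇔ (λ a i i∈p → a (suc i) (there i∈p))
      λ { a zero here → ¬P0 ; a (suc i) (there i∈p) → a i i∈p }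

  avoiding : ∀ {N} {P : Fin N → Set} → Decidable P → ∀ k →
    Decidable (λ p → size p ≡ k × Avoids P p)
  avoiding P? k p = (size p ≟ k) ×-dec avoids? P? p

  -- Split by membership of the first index. If that index is allowed, Pascal's rule adds the two
  -- halves; if it is forbidden, the half that contains it is empty.
  count-avoiding : ∀ {N} {P : Fin N → Set} (P? : Decidable P) k →
    length (filter (avoiding P? k) (allSubsets N)) ≡ (∑[ i < N ] ⟦ ¬? (P? i) ⟧) C k
  count-avoiding {zero} P? zero    = refl
  count-avoiding {zero} P? (suc k) = refl
  count-avoiding {suc N} {P} P? k = begin
    length (filter Q? (map (outside ∷_) S ++ map (inside ∷_) S))
      ≡⟨ cong length (filter-++ Q? (map (outside ∷_) S) (map (inside ∷_) S)) ⟩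
    length (filter Q? (map (outside ∷_) S) ++ filter Q? (map (inside ∷_) S))
      ≡⟨ length-++ (filter Q? (map (outside ∷_) S)) ⟩
    length (filter Q? (map (outside ∷_) S)) + length (filter Q? (map (inside ∷_) S))
      ≡⟨ cong₂ _+_ (length-filter-map Q? (outside ∷_) S) (length-filter-map Q? (inside ∷_) S) ⟩
    length (filter (Q? ∘ (outside ∷_)) S) + length (filter (Q? ∘ (inside ∷_)) S)
      ≡⟨ cong₂ _+_ without (with0 (P? zero) k) ⟩
    free C k + included (P? zero) k
      ≡⟨ combined (P? zero) k ⟩
    (⟦ ¬? (P? zero) ⟧ + free) C k ∎
    where
    open ≡-Reasoning
    open Function.Equivalence using (to; from)
    S = allSubsets N
    Q? = avoiding P? k
    free = ∑[ i < N ] ⟦ ¬? (P? (suc i)) ⟧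
    without : length (filter (Q? ∘ (outside ∷_)) S) ≡ free C k
    without = trans
      (cong length (filter-≐ (Q? ∘ (outside ∷_)) (avoiding (P? ∘ suc) k)
        (map₂ (to avoids-outside) , map₂ (from avoids-outside)) S))
      (count-avoiding (P? ∘ suc) k)
    -- The number of admissible subsets that contain index zero. The decision is an argument, so
    -- that matching on it also reduces the indicator in `combined`.
    included : Dec (P zero) → ℕ → ℕ
    included (yes _) _       = 0
    included (no _)  zero    = 0
    included (no _)  (suc k) = free C k
    with0 : ∀ d k → length (filter (avoiding P? k ∘ (inside ∷_)) S) ≡ included d k
    with0 (yes P0) k = cong length (filter-none _ (universal (λ p (_ , a) → a zero here P0) S))
    with0 (no ¬P0) zero = cong length (filter-none _ (universal (λ p (eq , _) → 1+n≢0 eq) S))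
    with0 (no ¬P0) (suc k) = trans
      (cong length (filter-≐ (avoiding P? (suc k) ∘ (inside ∷_)) (avoiding (P? ∘ suc) k)
        ( (λ (eq , a) → suc-injective eq , to (avoids-inside ¬P0) a)
        , (λ (eq , a) → cong suc eq , from (avoids-inside ¬P0) a)) S))
      (count-avoiding (P? ∘ suc) k)
    combined : ∀ d k → free C k + included d k ≡ (⟦ ¬? d ⟧ + free) C k
    combined (yes _) k       = +-identityʳ _
    combined (no _)  zero    = refl
    combined (no _)  (suc k) = trans (+-comm (free C suc k) (free C k)) (nCk+nC[k+1]≡[n+1]C[k+1] free k)

  -- Finite sums over `Fin`.

  ∑-1 : ∀ n → ∑[ i < n ] 1 ≡ n
  ∑-1 zero    = refl
  ∑-1 (suc n) = cong suc (∑-1 n)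

  ∑-complement : ∀ {N} {P : Fin N → Set} (P? : Decidable P) →
    ∑[ i < N ] ⟦ ¬? (P? i) ⟧ ≡ N ∸ ∑[ i < N ] ⟦ P? i ⟧
  ∑-complement {N} P? = begin
    ∑[ i < N ] ⟦ ¬? (P? i) ⟧
      ≡⟨ m+n∸n≡m _ (∑[ i < N ] ⟦ P? i ⟧) ⟨
    ∑[ i < N ] ⟦ ¬? (P? i) ⟧ + ∑[ i < N ] ⟦ P? i ⟧ ∸ ∑[ i < N ] ⟦ P? i ⟧
      ≡⟨ cong (_∸ ∑[ i < N ] ⟦ P? i ⟧) (∑-distrib-+ (λ i → ⟦ ¬? (P? i) ⟧) (λ i → ⟦ P? i ⟧)) ⟨
    ∑[ i < N ] (⟦ ¬? (P? i) ⟧ + ⟦ P? i ⟧) ∸ ∑[ i < N ] ⟦ P? i ⟧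
      ≡⟨ cong (_∸ ∑[ i < N ] ⟦ P? i ⟧) (trans (sum-cong-≗ (λ i → ⟦¬⟧+⟦⟧ (P? i))) (∑-1 N)) ⟩
    N ∸ ∑[ i < N ] ⟦ P? i ⟧ ∎
    where open ≡-Reasoning

  ∑-++ : ∀ m {n} (f : Fin (m + n) → ℕ) →
    sum f ≡ ∑[ i < m ] f (i ↑ˡ n) + ∑[ j < n ] f (m ↑ʳ j)
  ∑-++ zero    f = refl
  ∑-++ (suc m) f = trans (cong (f zero +_) (∑-++ m (f ∘ suc))) (sym (+-assoc (f zero) _ _))

  ∑-combine : ∀ m {n} (f : Fin (m * n) → ℕ) →
    sum f ≡ ∑[ i < m ] ∑[ j < n ] f (combine i j)
  ∑-combine zero        f = refl
  ∑-combine (suc m) {n} f = trans (∑-++ n f)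
    (cong (∑[ j < n ] f (j ↑ˡ m * n) +_) (∑-combine m (λ i → f (n ↑ʳ i))))

  ∑-last : ∀ n (f : ℕ → ℕ) → ∑[ i < suc n ] f (toℕ i) ≡ ∑[ i < n ] f (toℕ i) + f n
  ∑-last n f = trans (sum-init-last {n} (f ∘ toℕ))
    (cong₂ _+_ (sum-cong-≗ {n} (λ i → cong f (toℕ-inject₁ i))) (cong f (toℕ-fromℕ n)))

  ∑-list : ∀ {n} (f : Fin n → ℕ) → sumᴸ (map f (allFin n)) ≡ sum f
  ∑-list {n} f = trans (cong sumᴸ (map-tabulate (λ i → i) f)) (sum-tabulate f)
    where
    sum-tabulate : ∀ {n} (f : Fin n → ℕ) → sumᴸ (tabulate f) ≡ sum f
    sum-tabulate {zero}  f = refl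
    sum-tabulate {suc n} f = cong (f zero +_) (sum-tabulate (f ∘ suc))

  ∑-cartesianProduct : ∀ {A B : Set} (f : A × B → ℕ) xs ys →
    sumᴸ (map f (cartesianProduct xs ys)) ≡ sumᴸ (map (λ x → sumᴸ (map (λ y → f (x , y)) ys)) xs)
  ∑-cartesianProduct f []       ys = refl
  ∑-cartesianProduct f (x ∷ xs) ys = begin
    sumᴸ (map f (map (x ,_) ys ++ cartesianProduct xs ys))
      ≡⟨ cong sumᴸ (map-++ f (map (x ,_) ys) _) ⟩
    sumᴸ (map f (map (x ,_) ys) ++ map f (cartesianProduct xs ys))
      ≡⟨ sumᴸ-++ (map f (map (x ,_) ys)) _ ⟩
    sumᴸ (map f (map (x ,_) ys)) + sumᴸ (map f (cartesianProduct xs ys))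
      ≡⟨ cong₂ _+_ (cong sumᴸ (sym (map-∘ ys))) (∑-cartesianProduct f xs ys) ⟩
    sumᴸ (map (λ y → f (x , y)) ys) + sumᴸ (map (λ x → sumᴸ (map (λ y → f (x , y)) ys)) xs) ∎
    where open ≡-Reasoning

  -- The number of spaces from which a given space is attacked.

  -- Whether a queen attacks a space depends only on the distances d and e
  -- between their rows and between their columns.
  hit : ℕ → ℕ → ℕ
  hit zero    _       = 1
  hit (suc _) zero    = 1
  hit (suc d) (suc e) = ⟦ d ≟ e ⟧

  ⟦attacks?⟧ : ∀ {n} (i j x y : Fin n) →
    ⟦ attacks? (i , j) (x , y) ⟧ ≡ hit ∣ toℕ x - toℕ i ∣ ∣ toℕ y - toℕ j ∣
  ⟦attacks?⟧ i j x y = trans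
    (⟦⟧-cong (mk⇔ to from) (attacks? (i , j) (x , y)) (hits? d e))
    (hits d e)
    where
    d = ∣ toℕ x - toℕ i ∣
    e = ∣ toℕ y - toℕ j ∣
    hits? : ∀ d e → Dec (d ≡ 0 ⊎ e ≡ 0 ⊎ d ≡ e)
    hits? d e = (d ≟ 0) ⊎-dec ((e ≟ 0) ⊎-dec (d ≟ e))
    to : Attacks (i , j) (x , y) → d ≡ 0 ⊎ e ≡ 0 ⊎ d ≡ e
    to (inj₁ x≡i)        = inj₁ (m≡n⇒∣m-n∣≡0 (cong toℕ x≡i))
    to (inj₂ (inj₁ y≡j)) = inj₂ (inj₁ (m≡n⇒∣m-n∣≡0 (cong toℕ y≡j)))
    to (inj₂ (inj₂ d≡e)) = inj₂ (inj₂ d≡e)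
    from : d ≡ 0 ⊎ e ≡ 0 ⊎ d ≡ e → Attacks (i , j) (x , y)
    from (inj₁ d≡0)        = inj₁ (toℕ-injective (∣m-n∣≡0⇒m≡n d≡0))
    from (inj₂ (inj₁ e≡0)) = inj₂ (inj₁ (toℕ-injective (∣m-n∣≡0⇒m≡n e≡0)))
    from (inj₂ (inj₂ d≡e)) = inj₂ (inj₂ d≡e)
    hits : ∀ d e → ⟦ hits? d e ⟧ ≡ hit d e
    hits zero    e       = refl
    hits (suc d) zero    = refl
    hits (suc d) (suc e) = refl

  -- A line of cells is regrouped by distance from cell `y`, with `y` cells before it and `y′` after
  -- it. Induction on `y` removes the first cell, which is the farthest on its side.
  ∑-distance : ∀ {n} y y′ (g : ℕ → ℕ) → n ≡ suc (y + y′) →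
    ∑[ j < n ] g ∣ y - toℕ j ∣ ≡ g 0 + (∑[ d < y ] g (suc (toℕ d)) + ∑[ d < y′ ] g (suc (toℕ d)))
  ∑-distance zero    y′ g refl = refl
  ∑-distance (suc y) y′ g refl = begin
    g (suc y) + ∑[ j < suc (y + y′) ] g ∣ y - toℕ j ∣
      ≡⟨ cong (g (suc y) +_) (∑-distance y y′ g refl) ⟩
    g (suc y) + (g 0 + (a + b))
      ≡⟨ solve 4 (λ s z a b → s :+ (z :+ (a :+ b)) := z :+ ((a :+ s) :+ b)) refl (g (suc y)) (g 0) a b ⟩
    g 0 + (a + g (suc y) + b)
      ≡⟨ cong (λ s → g 0 + (s + b)) (∑-last y (g ∘ suc)) ⟨
    g 0 + (∑[ d < suc y ] g (suc (toℕ d)) + b) ∎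
    where
    open ≡-Reasoning
    a = ∑[ d < y ] g (suc (toℕ d))
    b = ∑[ d < y′ ] g (suc (toℕ d))

  ∑-diagonal : ∀ a b → ∑[ d < a ] ∑[ e < b ] ⟦ toℕ d ≟ toℕ e ⟧ ≡ a ⊓ b
  ∑-diagonal zero    b       = refl
  ∑-diagonal (suc a) zero    = sum-replicate-zero (suc a)
  ∑-diagonal (suc a) (suc b) = cong₂ (λ z s → suc z + s) (sum-replicate-zero b) (∑-diagonal a b)

  -- The row of the space itself contributes `n`. Every other row contributes its cell in the same
  -- column, and each of the four quadrants contributes a diagonal as long as its shorter side.
  ∑∑-hit : ∀ {n} x x′ y y′ → n ≡ suc (x + x′) → n ≡ suc (y + y′) →
    ∑[ i < n ] ∑[ j < n ] hit ∣ x - toℕ i ∣ ∣ y - toℕ j ∣ ≡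
    n + (x + (x ⊓ y + x ⊓ y′) + (x′ + (x′ ⊓ y + x′ ⊓ y′)))
  ∑∑-hit {n} x x′ y y′ n≡x n≡y = begin
    ∑[ i < n ] row ∣ x - toℕ i ∣
      ≡⟨ ∑-distance x x′ row n≡x ⟩
    row 0 + (∑[ d < x ] row (suc (toℕ d)) + ∑[ d < x′ ] row (suc (toℕ d)))
      ≡⟨ cong₂ _+_ (∑-1 n) (cong₂ _+_ (rows x) (rows x′)) ⟩
    n + (x + (x ⊓ y + x ⊓ y′) + (x′ + (x′ ⊓ y + x′ ⊓ y′))) ∎
    where
    open ≡-Reasoning
    row : ℕ → ℕ
    row d = ∑[ j < n ] hit d ∣ y - toℕ j ∣
    same : ℕ → ℕ → ℕ
    same d b = ∑[ e < b ] ⟦ d ≟ toℕ e ⟧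
    rows : ∀ a → ∑[ d < a ] row (suc (toℕ d)) ≡ a + (a ⊓ y + a ⊓ y′)
    rows a = begin
      ∑[ d < a ] row (suc (toℕ d))
        ≡⟨ sum-cong-≗ {a} (λ d → ∑-distance y y′ (hit (suc (toℕ d))) n≡y) ⟩
      ∑[ d < a ] (1 + (same (toℕ d) y + same (toℕ d) y′))
        ≡⟨ ∑-distrib-+ {a} (λ _ → 1) _ ⟩
      ∑[ d < a ] 1 + ∑[ d < a ] (same (toℕ d) y + same (toℕ d) y′)
        ≡⟨ cong₂ _+_ (∑-1 a) (∑-distrib-+ {a} (λ d → same (toℕ d) y) (λ d → same (toℕ d) y′)) ⟩
      a + (∑[ d < a ] same (toℕ d) y + ∑[ d < a ] same (toℕ d) y′)
        ≡⟨ cong (a +_) (cong₂ _+_ (∑-diagonal a y) (∑-diagonal a y′)) ⟩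
      a + (a ⊓ y + a ⊓ y′) ∎

  ⊓-least : ∀ {z x x′ y y′} → z ≤ x → z ≤ x′ → z ≤ y → z ≤ y′ →
    z ≡ x ⊎ z ≡ x′ ⊎ z ≡ y ⊎ z ≡ y′ → (x ⊓ x′) ⊓ (y ⊓ y′) ≡ z
  ⊓-least {z} {x} {x′} {y} {y′} z≤x z≤x′ z≤y z≤y′ z≡ =
    ≤-antisym (upper z≡) (⊓-glb (⊓-glb z≤x z≤x′) (⊓-glb z≤y z≤y′))
    where
    upper : z ≡ x ⊎ z ≡ x′ ⊎ z ≡ y ⊎ z ≡ y′ → (x ⊓ x′) ⊓ (y ⊓ y′) ≤ z
    upper (inj₁ refl)               = ≤-trans (m⊓n≤m (x ⊓ x′) _) (m⊓n≤m x x′)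
    upper (inj₂ (inj₁ refl))        = ≤-trans (m⊓n≤m (x ⊓ x′) _) (m⊓n≤n x x′)
    upper (inj₂ (inj₂ (inj₁ refl))) = ≤-trans (m⊓n≤n (x ⊓ x′) _) (m⊓n≤m y y′)
    upper (inj₂ (inj₂ (inj₂ refl))) = ≤-trans (m⊓n≤n (x ⊓ x′) _) (m⊓n≤n y y′)

  other-≤ : ∀ {x x′ y y′} → x + x′ ≡ y + y′ → x ≤ y → y′ ≤ x′
  other-≤ {x} {x′} {y} {y′} eq x≤y = +-cancelˡ-≤ y y′ x′
    (≤-trans (≤-reflexive (sym eq)) (+-monoˡ-≤ x′ x≤y))

  -- Because the two totals agree, `x ≤ y` forces `y′ ≤ x′`, and likewise for the other pairs.
  -- Comparing `x` with `y` and with `y′` therefore settles all four minima and shows which distance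
  -- is the least.
  ∑⊓ : ∀ x x′ y y′ → x + x′ ≡ y + y′ →
    x ⊓ y + x ⊓ y′ + (x′ ⊓ y + x′ ⊓ y′) ≡ x + x′ + 2 * ((x ⊓ x′) ⊓ (y ⊓ y′))
  ∑⊓ x x′ y y′ eq with ≤-total x y | ≤-total x y′
  ... | inj₁ x≤y | inj₁ x≤y′
    rewrite ⊓-least ≤-refl (≤-trans x≤y (other-≤ (trans eq (+-comm y y′)) x≤y′)) x≤y x≤y′ (inj₁ refl)
          | m≤n⇒m⊓n≡m x≤y | m≤n⇒m⊓n≡m x≤y′
          | m≥n⇒m⊓n≡n (other-≤ eq x≤y) | m≥n⇒m⊓n≡n (other-≤ (trans eq (+-comm y y′)) x≤y′)
    = trans (solve 3 (λ x y y′ → x :+ x :+ (y :+ y′) := y :+ y′ :+ con 2 :* x) refl x y y′)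
        (cong (_+ 2 * x) (sym eq))
  ... | inj₁ x≤y | inj₂ y′≤x
    rewrite ⊓-least y′≤x (other-≤ eq x≤y) (≤-trans y′≤x x≤y) ≤-refl (inj₂ (inj₂ (inj₂ refl)))
          | m≤n⇒m⊓n≡m x≤y | m≥n⇒m⊓n≡n y′≤x
          | m≥n⇒m⊓n≡n (other-≤ eq x≤y) | m≤n⇒m⊓n≡m (other-≤ (trans (+-comm y′ y) (sym eq)) y′≤x)
    = solve 3 (λ x x′ y′ → x :+ y′ :+ (x′ :+ y′) := x :+ x′ :+ con 2 :* y′) refl x x′ y′
  ... | inj₂ y≤x | inj₁ x≤y′
    rewrite ⊓-least y≤x (other-≤ (trans eq (+-comm y y′)) x≤y′) ≤-refl (≤-trans y≤x x≤y′) (inj₂ (inj₂ (inj₁ refl)))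
          | m≥n⇒m⊓n≡n y≤x | m≤n⇒m⊓n≡m x≤y′
          | m≤n⇒m⊓n≡m (other-≤ (sym eq) y≤x) | m≥n⇒m⊓n≡n (other-≤ (trans eq (+-comm y y′)) x≤y′)
    = solve 3 (λ x x′ y → y :+ x :+ (y :+ x′) := x :+ x′ :+ con 2 :* y) refl x x′ y
  ... | inj₂ y≤x | inj₂ y′≤x
    rewrite ⊓-least (≤-trans (other-≤ (sym eq) y≤x) y′≤x) ≤-refl (other-≤ (trans (+-comm y′ y) (sym eq)) y′≤x) (other-≤ (sym eq) y≤x) (inj₂ (inj₁ refl))
          | m≥n⇒m⊓n≡n y≤x | m≥n⇒m⊓n≡n y′≤x
          | m≤n⇒m⊓n≡m (other-≤ (sym eq) y≤x) | m≤n⇒m⊓n≡m (other-≤ (trans (+-comm y′ y) (sym eq)) y′≤x)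
    = trans (solve 3 (λ y y′ x′ → y :+ y′ :+ (x′ :+ x′) := y :+ y′ :+ con 2 :* x′) refl y y′ x′)
        (cong (_+ 2 * x′) (sym eq))

  -- The distance to the border, in 0-based coordinates.
  depth : ℕ → ℕ → ℕ → ℕ
  depth n x y = (x ⊓ (n ∸ suc x)) ⊓ (y ⊓ (n ∸ suc y))

  -- The number of spaces from which (x , y) is attacked, including itself.
  reach : ℕ → ℕ → ℕ → ℕ
  reach n x y = (3 * n ∸ 2) + 2 * depth n x y

  count-attacks : ∀ {n} (x y : Fin n) →
    ∑[ i < n ] ∑[ j < n ] ⟦ attacks? (i , j) (x , y) ⟧ ≡ reach n (toℕ x) (toℕ y)
  count-attacks {suc k} x y = begin
    ∑[ i < suc k ] ∑[ j < suc k ] ⟦ attacks? (i , j) (x , y) ⟧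
      ≡⟨ sum-cong-≗ (λ i → sum-cong-≗ (λ j → ⟦attacks?⟧ i j x y)) ⟩
    ∑[ i < suc k ] ∑[ j < suc k ] hit ∣ toℕ x - toℕ i ∣ ∣ toℕ y - toℕ j ∣
      ≡⟨ ∑∑-hit a a′ b b′ (cong suc (sym a+a′)) (cong suc (sym b+b′)) ⟩
    suc k + (a + (a ⊓ b + a ⊓ b′) + (a′ + (a′ ⊓ b + a′ ⊓ b′)))
      ≡⟨ solve 5 (λ n a a′ s s′ → n :+ (a :+ s :+ (a′ :+ s′)) := n :+ (a :+ a′ :+ (s :+ s′))) refl
           (suc k) a a′ (a ⊓ b + a ⊓ b′) (a′ ⊓ b + a′ ⊓ b′) ⟩
    suc k + (a + a′ + (a ⊓ b + a ⊓ b′ + (a′ ⊓ b + a′ ⊓ b′)))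
      ≡⟨ cong (λ s → suc k + (a + a′ + s)) (∑⊓ a a′ b b′ (trans a+a′ (sym b+b′))) ⟩
    suc k + (a + a′ + (a + a′ + 2 * r))
      ≡⟨ cong (λ s → suc k + (s + (s + 2 * r))) a+a′ ⟩
    suc k + (k + (k + 2 * r))
      ≡⟨ solve 2 (λ k r → con 1 :+ k :+ (k :+ (k :+ con 2 :* r)) := con 1 :+ con 3 :* k :+ con 2 :* r) refl k r ⟩
    suc (3 * k) + 2 * r
      ≡⟨ cong (λ m → m ∸ 2 + 2 * r) (sym (*-suc 3 k)) ⟩
    3 * suc k ∸ 2 + 2 * r ∎
    where
    open ≡-Reasoning
    a = toℕ x
    a′ = k ∸ a
    b = toℕ y
    b′ = k ∸ b
    r = (a ⊓ a′) ⊓ (b ⊓ b′)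
    a+a′ : a + a′ ≡ k
    a+a′ = m+[n∸m]≡n (s≤s⁻¹ (toℕ<n x))
    b+b′ : b + b′ ≡ k
    b+b′ = m+[n∸m]≡n (s≤s⁻¹ (toℕ<n y))

  -- From attack counts to the total number of safe spaces.

  -- Every space attacks itself, so a queen standing on `s` is also a queen attacking `s`. Safety
  -- thus becomes avoidance of a single set of indices, the form that `count-avoiding` handles.
  safe≐avoids : ∀ {n} (s : Space n) →
    (λ p → size p ≡ n × Safe n p s) ≐
    (λ p → size p ≡ n × Avoids (λ k → Attacks (remQuot n k) s) p)
  safe≐avoids {n} s@(x , y) = map₂ to , map₂ from
    where
    to : ∀ {p} → Safe n p s → Avoids (λ k → Attacks (remQuot n k) s) p
    to {p} (_ , unattacked) k k∈p =
      uncurry unattacked (remQuot n k) (subst (_∈ p) (sym (combine-remQuot {n} n k)) k∈p)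
    from : ∀ {p} → Avoids (λ k → Attacks (remQuot n k) s) p → Safe n p s
    from {p} a = (λ occ → unattacked x y occ (inj₁ refl)) , unattacked
      where
      unattacked : ∀ i j → combine i j ∈ p → ¬ Attacks (i , j) s
      unattacked i j occ att =
        a (combine i j) occ (subst (λ t → Attacks t s) (sym (remQuot-combine i j)) att)

  count-safe : ∀ {n} (x y : Fin n) →
    length (filter (λ p → safe? n p (x , y)) (placements n)) ≡ (n * n ∸ reach n (toℕ x) (toℕ y)) C n
  count-safe {n} x y = begin
    length (filter (λ p → safe? n p s) (placements n))
      ≡⟨ cong length (filter-filter (λ p → safe? n p s) (λ p → size p ≟ n) (allSubsets (n * n))) ⟩
    length (filter (λ p → (size p ≟ n) ×-dec safe? n p s) (allSubsets (n * n)))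
      ≡⟨ cong length (filter-≐ _ (avoiding attacking? n) (safe≐avoids s) (allSubsets (n * n))) ⟩
    length (filter (avoiding attacking? n) (allSubsets (n * n)))
      ≡⟨ count-avoiding attacking? n ⟩
    (∑[ k < n * n ] ⟦ ¬? (attacking? k) ⟧) C n
      ≡⟨ cong (_C n) (∑-complement attacking?) ⟩
    (n * n ∸ ∑[ k < n * n ] ⟦ attacking? k ⟧) C n
      ≡⟨ cong (λ a → (n * n ∸ a) C n) attackers ⟩
    (n * n ∸ reach n (toℕ x) (toℕ y)) C n ∎
    where
    open ≡-Reasoning
    s = x , y
    attacking? : Decidable (λ k → Attacks (remQuot n k) s)
    attacking? k = attacks? (remQuot n k) s
    attackers : ∑[ k < n * n ] ⟦ attacking? k ⟧ ≡ reach n (toℕ x) (toℕ y)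
    attackers = begin
      ∑[ k < n * n ] ⟦ attacking? k ⟧
        ≡⟨ ∑-combine n (⟦_⟧ ∘ attacking?) ⟩
      ∑[ i < n ] ∑[ j < n ] ⟦ attacks? (remQuot n (combine i j)) s ⟧
        ≡⟨ sum-cong-≗ (λ i → sum-cong-≗ (λ j → cong (λ t → ⟦ attacks? t s ⟧) (remQuot-combine i j))) ⟩
      ∑[ i < n ] ∑[ j < n ] ⟦ attacks? (i , j) s ⟧
        ≡⟨ count-attacks x y ⟩
      reach n (toℕ x) (toℕ y) ∎

  total-safe : ∀ n → sumᴸ (map (safeCount n) (placements n)) ≡
    ∑[ x < n ] ∑[ y < n ] ((n * n ∸ reach n (toℕ x) (toℕ y)) C n)
  total-safe n = begin
    sumᴸ (map (safeCount n) (placements n))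
      ≡⟨ double-counting (safe? n) (placements n) (cartesianProduct (allFin n) (allFin n)) ⟩
    sumᴸ (map count (cartesianProduct (allFin n) (allFin n)))
      ≡⟨ ∑-cartesianProduct count (allFin n) (allFin n) ⟩
    sumᴸ (map (λ x → sumᴸ (map (λ y → count (x , y)) (allFin n))) (allFin n))
      ≡⟨ ∑-list (λ x → sumᴸ (map (λ y → count (x , y)) (allFin n))) ⟩
    ∑[ x < n ] sumᴸ (map (λ y → count (x , y)) (allFin n))
      ≡⟨ sum-cong-≗ (λ x → trans (∑-list (λ y → count (x , y))) (sum-cong-≗ (count-safe x))) ⟩
    ∑[ x < n ] ∑[ y < n ] ((n * n ∸ reach n (toℕ x) (toℕ y)) C n) ∎
    where
    open ≡-Reasoning
    count : Space n → ℕ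
    count s = length (filter (λ p → safe? n p s) (placements n))

  length-placements : ∀ n → length (placements n) ≡ (n * n) C n
  length-placements n = begin
    length (placements n)
      ≡⟨ cong length (filter-≐ (λ p → size p ≟ n) (avoiding never? n)
           ((λ eq → eq , λ _ _ ()) , proj₁) (allSubsets (n * n))) ⟩
    length (filter (avoiding never? n) (allSubsets (n * n)))
      ≡⟨ count-avoiding never? n ⟩
    (∑[ k < n * n ] 1) C n
      ≡⟨ cong (_C n) (∑-1 (n * n)) ⟩
    (n * n) C n ∎
    where
    open ≡-Reasoning
    never? : Decidable {A = Fin (n * n)} (λ _ → ⊥)
    never? _ = no λ ()

  -- The identity `(M + 1) (M C k) = (M + 1 − k) (suc M C k)` with the subtraction moved across,
  -- which makes it valid for every `k`. It holds by Pascal's rule and induction, and yields the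
  -- ratio `1 − k / (M + 1)` of consecutive binomials.
  absorption : ∀ M k → suc M * (M C k) + k * (suc M C k) ≡ suc M * (suc M C k)
  absorption M zero = +-identityʳ _
  absorption zero (suc zero) = refl
  absorption zero (suc (suc k)) = *-zeroʳ k
  absorption (suc M) (suc k) = begin
    suc (suc M) * (suc M C suc k) + suc k * (suc (suc M) C suc k)
      ≡⟨ cong (λ c → suc (suc M) * (suc M C suc k) + suc k * c) (nCk+nC[k+1]≡[n+1]C[k+1] (suc M) k) ⟨
    suc (suc M) * b′ + suc k * (a′ + b′)
      ≡⟨ solve 4 (λ m k a b → (con 2 :+ m) :* b :+ (con 1 :+ k) :* (a :+ b) :=
                    (con 1 :+ m) :* b :+ (con 1 :+ k) :* b :+ (k :* a :+ a :+ b)) refl M k a′ b′ ⟩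
    suc M * b′ + suc k * b′ + (k * a′ + a′ + b′)
      ≡⟨ cong (λ c → suc M * c + suc k * b′ + (k * a′ + a′ + b′)) (nCk+nC[k+1]≡[n+1]C[k+1] M k) ⟨
    suc M * (a + b) + suc k * b′ + (k * a′ + a′ + b′)
      ≡⟨ solve 6 (λ m k a b a′ b′ → (con 1 :+ m) :* (a :+ b) :+ (con 1 :+ k) :* b′ :+ (k :* a′ :+ a′ :+ b′) :=
                    ((con 1 :+ m) :* a :+ k :* a′) :+ ((con 1 :+ m) :* b :+ (con 1 :+ k) :* b′) :+ (a′ :+ b′))
           refl M k a b a′ b′ ⟩
    (suc M * a + k * a′) + (suc M * b + suc k * b′) + (a′ + b′)
      ≡⟨ cong₂ (λ p q → p + q + (a′ + b′)) (absorption M k) (absorption M (suc k)) ⟩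
    suc M * a′ + suc M * b′ + (a′ + b′)
      ≡⟨ solve 3 (λ m a b → (con 1 :+ m) :* a :+ (con 1 :+ m) :* b :+ (a :+ b) := (con 2 :+ m) :* (a :+ b)) refl M a′ b′ ⟩
    suc (suc M) * (a′ + b′)
      ≡⟨ cong (suc (suc M) *_) (nCk+nC[k+1]≡[n+1]C[k+1] (suc M) k) ⟩
    suc (suc M) * (suc (suc M) C suc k) ∎
    where
    open ≡-Reasoning
    a = M C k
    b = M C suc k
    a′ = suc M C k
    b′ = suc M C suc k

-- Rational estimates and the two limits.

module Asymptotics where

  open import Algebra.Bundles using (CommutativeRing)
  open import Data.Fin using (Fin; zero; suc; toℕ)
  open import Data.Fin.Properties using (toℕ<n; toℕ-inject₁; toℕ-fromℕ)
  import Data.Integer as ℤ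
  import Data.Integer.Properties as ℤₚ
  open import Data.List using (length; map)
  open import Data.Nat using (ℕ; zero; suc; z≤n; s≤s; _∸_)
  import Data.Nat as ℕ
  open import Data.Nat.Combinatorics using (_C_)
  open import Data.Nat.ListAction using () renaming (sum to sumᴸ)
  import Data.Nat.Properties as ℕₚ
  import Data.Nat.Solver as ℕ-Solver
  open import Data.Product using (_,_; proj₁; proj₂)
  open import Data.Rational
  open import Data.Rational.Properties
  open import Data.Rational.Solver using (module +-*-Solver)
  import Data.Rational.Unnormalised as ℚᵘ
  import Data.Rational.Unnormalised.Properties as ℚᵘₚ
  open import Function using (_∘_)
  open import Relation.Binary.PropositionalEquality using (_≡_; _≢_; refl; sym; trans; cong; cong₂; subst)

  open import Algebra.Properties.Semiring.Sum (CommutativeRing.semiring +-*-commutativeRing)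
  open import Algebra.Properties.Semiring.Exp (CommutativeRing.semiring +-*-commutativeRing) using (_^_; ^-homo-*; ^-assocʳ)
  open import Algebra.Properties.Semiring.Sum ℕₚ.+-*-semiring using () renaming (sum to sumℕ)
  open import Defs using (Σ1/k!; 𝔼S; μ; safeCount; placements; placements-nonEmpty; seq; recip; Sequence; _⟶_)
  open Defs.CauchyLemmas using (*-monoˡ; *-monoʳ; *-recip; recip-pos; pos≢0; *-pos; archimedean; 1/-*; 1/-anti; 1/-pos; 1/!_; 1/!-pos; 1/!-suc; half+half; 0<½; 0<1; ∣∣-≤)
  open +-*-Solver using (solve; _:+_; _:*_; _:-_; :-_; _:=_; con)
  open Counting using (absorption; depth; reach; total-safe; length-placements)

  ι : ℕ → ℚ
  ι n = ℤ.+ n / 1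

  toℚᵘ-/ : ∀ a b .{{_ : ℕ.NonZero b}} → toℚᵘ (ℤ.+ a / b) ℚᵘ.≃ ℤ.+ a ℚᵘ./ b
  toℚᵘ-/ a (suc b) = toℚᵘ-fromℚᵘ (ℚᵘ.mkℚᵘ (ℤ.+ a) b)

  /-*-cancel : ∀ a b .{{_ : ℕ.NonZero b}} → (ℤ.+ a / b) * ι b ≡ ι a
  /-*-cancel a b@(suc _) = toℚᵘ-injective (ℚᵘₚ.≃-trans (toℚᵘ-homo-* (ℤ.+ a / b) (ι b))
    (ℚᵘₚ.≃-trans (ℚᵘₚ.*-cong (toℚᵘ-/ a b) (toℚᵘ-/ b 1))
    (ℚᵘₚ.≃-trans (ℚᵘ.*≡* (ℤₚ.*-assoc (ℤ.+ a) (ℤ.+ b) (ℤ.+ 1))) (ℚᵘₚ.≃-sym (toℚᵘ-/ a 1)))))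

  ι-+ : ∀ a b → ι (a ℕ.+ b) ≡ ι a + ι b
  ι-+ a b = toℚᵘ-injective (ℚᵘₚ.≃-trans (toℚᵘ-/ (a ℕ.+ b) 1)
    (ℚᵘₚ.≃-trans (ℚᵘ.*≡* (cong (ℤ._* ℤ.+ 1) (cong₂ ℤ._+_ (sym (ℤₚ.*-identityʳ (ℤ.+ a))) (sym (ℤₚ.*-identityʳ (ℤ.+ b))))))
    (ℚᵘₚ.≃-trans (ℚᵘₚ.+-cong (ℚᵘₚ.≃-sym (toℚᵘ-/ a 1)) (ℚᵘₚ.≃-sym (toℚᵘ-/ b 1))) (ℚᵘₚ.≃-sym (toℚᵘ-homo-+ (ι a) (ι b))))))

  ι-* : ∀ a b → ι (a ℕ.* b) ≡ ι a * ι b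
  ι-* a b = toℚᵘ-injective (ℚᵘₚ.≃-trans (toℚᵘ-/ (a ℕ.* b) 1)
    (ℚᵘₚ.≃-trans (ℚᵘ.*≡* (cong (ℤ._* ℤ.+ 1) (ℤₚ.pos-* a b)))
    (ℚᵘₚ.≃-trans (ℚᵘₚ.*-cong (ℚᵘₚ.≃-sym (toℚᵘ-/ a 1)) (ℚᵘₚ.≃-sym (toℚᵘ-/ b 1))) (ℚᵘₚ.≃-sym (toℚᵘ-homo-* (ι a) (ι b))))))

  ι-mono : ∀ {a b} → a ℕ.≤ b → ι a ≤ ι b
  ι-mono {a} {b} a≤b = toℚᵘ-cancel-≤ (ℚᵘₚ.≤-respˡ-≃ (ℚᵘₚ.≃-sym (toℚᵘ-/ a 1))
    (ℚᵘₚ.≤-respʳ-≃ (ℚᵘₚ.≃-sym (toℚᵘ-/ b 1)) (ℚᵘ.*≤* (ℤₚ.*-monoʳ-≤-nonNeg (ℤ.+ 1) (ℤ.+≤+ a≤b)))))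

  0≤ι : ∀ n → 0ℚ ≤ ι n
  0≤ι n = ι-mono {0} {n} z≤n

  0≤1 : 0ℚ ≤ 1ℚ
  0≤1 = 0≤ι 1

  0≤+ : ∀ {p q} → 0ℚ ≤ p → 0ℚ ≤ q → 0ℚ ≤ p + q
  0≤+ = +-mono-≤

  0≤* : ∀ {p q} → 0ℚ ≤ p → 0ℚ ≤ q → 0ℚ ≤ p * q
  0≤* {p} {q} 0≤p 0≤q = subst (_≤ p * q) (*-zeroʳ p) (*-monoˡ 0≤p 0≤q)

  *-mono : ∀ {p q r s} → 0ℚ ≤ r → 0ℚ ≤ q → p ≤ q → r ≤ s → p * r ≤ q * s
  *-mono 0≤r 0≤q p≤q r≤s = ≤-trans (*-monoʳ 0≤r p≤q) (*-monoˡ 0≤q r≤s)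

  -- The certificate form of an inequality: the ring solver verifies the identity, and only the sign
  -- of the remainder `r` has to be argued.
  ≤-by : ∀ {p q} r → 0ℚ ≤ r → q ≡ p + r → p ≤ q
  ≤-by {p} r 0≤r refl = subst (_≤ p + r) (+-identityʳ p) (+-monoʳ-≤ p 0≤r)

  ≤⇒0≤- : ∀ {p q} → p ≤ q → 0ℚ ≤ q - p
  ≤⇒0≤- {p} {q} p≤q = subst (_≤ q - p) (+-inverseʳ p) (+-monoˡ-≤ (- p) p≤q)

  0≤^ : ∀ {q} n → 0ℚ ≤ q → 0ℚ ≤ q ^ n
  0≤^ zero    0≤q = 0≤1
  0≤^ (suc n) 0≤q = 0≤* 0≤q (0≤^ n 0≤q)

  ^≤1 : ∀ {q} n → 0ℚ ≤ q → q ≤ 1ℚ → q ^ n ≤ 1ℚ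
  ^≤1 zero    0≤q q≤1 = ≤-refl
  ^≤1 (suc n) 0≤q q≤1 = *-mono (0≤^ n 0≤q) 0≤1 q≤1 (^≤1 n 0≤q q≤1)

  1≤^ : ∀ {q} n → 1ℚ ≤ q → 1ℚ ≤ q ^ n
  1≤^ zero    1≤q = ≤-refl
  1≤^ (suc n) 1≤q = *-mono 0≤1 (≤-trans 0≤1 1≤q) 1≤q (1≤^ n 1≤q)

  ^-distrib-* : ∀ p q n → (p * q) ^ n ≡ p ^ n * q ^ n
  ^-distrib-* p q zero    = refl
  ^-distrib-* p q (suc n) = trans (cong (p * q *_) (^-distrib-* p q n))
    (solve 4 (λ a b c d → a :* b :* (c :* d) := a :* c :* (b :* d)) refl p q (p ^ n) (q ^ n))

  bernoulli : ∀ {s} n → 0ℚ ≤ s → s ≤ 1ℚ → 1ℚ - ι n * s ≤ (1ℚ - s) ^ n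
  bernoulli {s} zero    0≤s s≤1 = ≤-reflexive (solve 1 (λ s → con 1ℚ :- con 0ℚ :* s := con 1ℚ) refl s)
  bernoulli {s} (suc n) 0≤s s≤1 = begin
    1ℚ - ι (suc n) * s
      ≡⟨ cong (λ m → 1ℚ - m * s) (ι-+ 1 n) ⟩
    1ℚ - (1ℚ + ι n) * s
      ≤⟨ ≤-by (ι n * (s * s)) (0≤* (0≤ι n) (0≤* 0≤s 0≤s))
           (solve 2 (λ s n → (con 1ℚ :- s) :* (con 1ℚ :- n :* s) :=
                     con 1ℚ :- (con 1ℚ :+ n) :* s :+ n :* (s :* s)) refl s (ι n)) ⟩
    (1ℚ - s) * (1ℚ - ι n * s)
      ≤⟨ *-monoˡ (≤⇒0≤- s≤1) (bernoulli n 0≤s s≤1) ⟩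
    (1ℚ - s) * (1ℚ - s) ^ n ∎
    where open ≤-Reasoning

  ∑-mono : ∀ {n} {f g : Fin n → ℚ} → (∀ i → f i ≤ g i) → sum f ≤ sum g
  ∑-mono {zero}  f≤g = ≤-refl
  ∑-mono {suc n} f≤g = +-mono-≤ (f≤g zero) (∑-mono (f≤g ∘ suc))

  ∑-const : ∀ n c → ∑[ i < n ] c ≡ ι n * c
  ∑-const zero    c = sym (*-zeroˡ c)
  ∑-const (suc n) c = begin-equality
    c + ∑[ i < n ] c   ≡⟨ cong (c +_) (∑-const n c) ⟩
    c + ι n * c        ≡⟨ solve 2 (λ c n → c :+ n :* c := (con 1ℚ :+ n) :* c) refl c (ι n) ⟩
    (1ℚ + ι n) * c     ≡⟨ cong (_* c) (ι-+ 1 n) ⟨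
    ι (suc n) * c      ∎
    where open ≤-Reasoning

  ∑-last : ∀ n (f : ℕ → ℚ) → ∑[ i < suc n ] f (toℕ i) ≡ ∑[ i < n ] f (toℕ i) + f n
  ∑-last n f = trans (sum-init-last {n} (f ∘ toℕ))
    (cong₂ _+_ (sum-cong-≗ {n} (λ i → cong f (toℕ-inject₁ i))) (cong f (toℕ-fromℕ n)))

  -- Truncated exponentials.

  -- exp k is the Taylor polynomial of degree k − 1. Increasing its argument by t
  -- multiplies it by at least 1 + t, up to one degree, and at most by 1 / (1 − t).
  exp : ℕ → ℚ → ℚ
  exp zero    x = 0ℚ
  exp (suc k) x = exp k x + x ^ k * 1/! k

  0≤1/! : ∀ k → 0ℚ ≤ 1/! k
  0≤1/! k = <⇒≤ (1/!-pos k)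

  ι-*-1/! : ∀ k → ι (suc k) * 1/! (suc k) ≡ 1/! k
  ι-*-1/! k = begin-equality
    ι (suc k) * 1/! (suc k)               ≡⟨ cong (ι (suc k) *_) (1/!-suc k) ⟩
    ι (suc k) * ((ℤ.+ 1 / suc k) * 1/! k)   ≡⟨ solve 3 (λ a b c → a :* (b :* c) := b :* a :* c) refl (ι (suc k)) (ℤ.+ 1 / suc k) (1/! k) ⟩
    (ℤ.+ 1 / suc k) * ι (suc k) * 1/! k     ≡⟨ cong (_* 1/! k) (/-*-cancel 1 (suc k)) ⟩
    1ℚ * 1/! k                            ≡⟨ *-identityˡ (1/! k) ⟩
    1/! k                                 ∎
    where open ≤-Reasoning

  1^ : ∀ n → 1ℚ ^ n ≡ 1ℚ
  1^ zero    = refl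
  1^ (suc n) = trans (*-identityˡ _) (1^ n)

  exp-1 : ∀ k → exp k 1ℚ ≡ Σ1/k! k
  exp-1 zero    = refl
  exp-1 (suc k) = cong₂ _+_ (exp-1 k) (trans (cong (_* 1/! k) (1^ k)) (*-identityˡ (1/! k)))

  exp-step : ∀ {x} k → 0ℚ ≤ x → exp k x ≤ exp (suc k) x
  exp-step k 0≤x = ≤-by _ (0≤* (0≤^ k 0≤x) (0≤1/! k)) refl

  1≤exp : ∀ {x} k → 0ℚ ≤ x → 1ℚ ≤ exp (suc k) x
  1≤exp zero    0≤x = ≤-refl
  1≤exp (suc k) 0≤x = ≤-trans (1≤exp k 0≤x) (exp-step (suc k) 0≤x)

  0≤exp : ∀ {x} k → 0ℚ ≤ x → 0ℚ ≤ exp k x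
  0≤exp zero    0≤x = ≤-refl
  0≤exp (suc k) 0≤x = ≤-trans 0≤1 (1≤exp k 0≤x)

  module _ {x t : ℚ} (0≤x : 0ℚ ≤ x) (0≤t : 0ℚ ≤ t) where

    open ≤-Reasoning

    -- With `^-+-lower`, a mean value theorem without derivatives: the increment of the power over a
    -- step `t` lies between `t` times the slope at the left end and `t` times the slope at the
    -- right end.
    ^-+-upper : ∀ k → (x + t) ^ suc k ≤ x ^ suc k + ι (suc k) * (t * (x + t) ^ k)
    ^-+-upper zero = ≤-reflexive
      (solve 2 (λ x t → (x :+ t) :* con 1ℚ := x :* con 1ℚ :+ con 1ℚ :* (t :* con 1ℚ)) refl x t)
    ^-+-upper (suc k) = begin
      (x + t) * y
        ≡⟨ *-distribʳ-+ y x t ⟩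
      x * y + t * y
        ≤⟨ +-monoˡ-≤ (t * y) (*-monoˡ 0≤x (^-+-upper k)) ⟩
      x * (a + m * (t * z)) + t * y
        ≤⟨ ≤-by (t * (m * (t * z))) (0≤* 0≤t (0≤* (0≤ι (suc k)) (0≤* 0≤t (0≤^ k (0≤+ 0≤x 0≤t)))))
             (solve 5 (λ x t a m z → x :* a :+ (con 1ℚ :+ m) :* (t :* ((x :+ t) :* z)) :=
                x :* (a :+ m :* (t :* z)) :+ t :* ((x :+ t) :* z) :+ t :* (m :* (t :* z))) refl x t a m z) ⟩
      x * a + (1ℚ + m) * (t * y)
        ≡⟨ cong (λ c → x * a + c * (t * y)) (ι-+ 1 (suc k)) ⟨
      x * a + ι (suc (suc k)) * (t * y) ∎
      where
      a = x ^ suc k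
      m = ι (suc k)
      z = (x + t) ^ k
      y = (x + t) ^ suc k

    ^-+-lower : ∀ k → x ^ suc k + ι (suc k) * (t * x ^ k) ≤ (x + t) ^ suc k
    ^-+-lower zero = ≤-reflexive
      (solve 2 (λ x t → x :* con 1ℚ :+ con 1ℚ :* (t :* con 1ℚ) := (x :+ t) :* con 1ℚ) refl x t)
    ^-+-lower (suc k) = begin
      x * (x * z) + ι (suc (suc k)) * (t * (x * z))
        ≡⟨ cong (λ c → x * (x * z) + c * (t * (x * z))) (ι-+ 1 (suc k)) ⟩
      x * (x * z) + (1ℚ + m) * (t * (x * z))
        ≤⟨ ≤-by (m * (t * (t * z))) (0≤* (0≤ι (suc k)) (0≤* 0≤t (0≤* 0≤t (0≤^ k 0≤x))))
             (solve 4 (λ x t m z → (x :+ t) :* (x :* z :+ m :* (t :* z)) :=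
                x :* (x :* z) :+ (con 1ℚ :+ m) :* (t :* (x :* z)) :+ m :* (t :* (t :* z))) refl x t m z) ⟩
      (x + t) * (x * z + m * (t * z))
        ≤⟨ *-monoˡ (0≤+ 0≤x 0≤t) (^-+-lower k) ⟩
      (x + t) * (x + t) ^ suc k ∎
      where
      m = ι (suc k)
      z = x ^ k

    term-cancel : ∀ k c → ι (suc k) * c * 1/! (suc k) ≡ c * 1/! k
    term-cancel k c = trans
      (solve 3 (λ m c f → m :* c :* f := c :* (m :* f)) refl (ι (suc k)) c (1/! (suc k)))
      (cong (c *_) (ι-*-1/! k))

    -- The derivative of `exp (suc k)` is `exp k`, so the bounds for powers add up term by term;
    -- `term-cancel` lowers the factorial along with the exponent.
    exp-+-upper : ∀ k → exp (suc k) (x + t) ≤ exp (suc k) x + t * exp k (x + t)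
    exp-+-upper zero = ≤-reflexive (solve 1 (λ t → con 1ℚ := con 1ℚ :+ t :* con 0ℚ) refl t)
    exp-+-upper (suc k) = begin
      exp (suc k) (x + t) + (x + t) ^ suc k * f
        ≤⟨ +-mono-≤ (exp-+-upper k) (*-monoʳ (0≤1/! (suc k)) (^-+-upper k)) ⟩
      a + t * b + (c + ι (suc k) * (t * d)) * f
        ≡⟨ cong (a + t * b +_) (trans (*-distribʳ-+ f c _) (cong (c * f +_) (term-cancel k (t * d)))) ⟩
      a + t * b + (c * f + t * d * 1/! k)
        ≡⟨ solve 6 (λ a b t g d h → a :+ t :* b :+ (g :+ t :* d :* h) := a :+ g :+ t :* (b :+ d :* h)) refl a b t (c * f) d (1/! k) ⟩
      a + c * f + t * (b + d * 1/! k) ∎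
      where
      f = 1/! (suc k)
      a = exp (suc k) x
      b = exp k (x + t)
      c = x ^ suc k
      d = (x + t) ^ k

    exp-+-lower : ∀ k → exp (suc k) x + t * exp k x ≤ exp (suc k) (x + t)
    exp-+-lower zero = ≤-reflexive (solve 1 (λ t → con 1ℚ :+ t :* con 0ℚ := con 1ℚ) refl t)
    exp-+-lower (suc k) = begin
      a + c * f + t * (b + d * 1/! k)
        ≡⟨ solve 6 (λ a b t g d h → a :+ g :+ t :* (b :+ d :* h) := a :+ t :* b :+ (g :+ t :* d :* h)) refl a b t (c * f) d (1/! k) ⟩
      a + t * b + (c * f + t * d * 1/! k)
        ≡⟨ cong (a + t * b +_) (trans (*-distribʳ-+ f c _) (cong (c * f +_) (term-cancel k (t * d)))) ⟨
      a + t * b + (c + ι (suc k) * (t * d)) * f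
        ≤⟨ +-mono-≤ (exp-+-lower k) (*-monoʳ (0≤1/! (suc k)) (^-+-lower k)) ⟩
      exp (suc k) (x + t) + (x + t) ^ suc k * f ∎
      where
      f = 1/! (suc k)
      a = exp (suc k) x
      b = exp k x
      c = x ^ suc k
      d = x ^ k

    -- Enlarging `exp k` to `exp (suc k)` in `exp-+-upper` makes both sides have the same degree, so
    -- the step can be iterated at a fixed degree.
    exp-decay : ∀ k → (1ℚ - t) * exp k (x + t) ≤ exp k x
    exp-decay zero    = ≤-reflexive (*-zeroʳ (1ℚ - t))
    exp-decay (suc k) = ≤-by (b + t * c - a + t * (a - c))
      (0≤+ (≤⇒0≤- (exp-+-upper k)) (0≤* 0≤t (≤⇒0≤- (exp-step k (0≤+ 0≤x 0≤t)))))
      (solve 4 (λ a b c t → b := (con 1ℚ :- t) :* a :+ (b :+ t :* c :- a :+ t :* (a :- c))) refl a b c t)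
      where
      a = exp (suc k) (x + t)
      b = exp (suc k) x
      c = exp k (x + t)

    -- Here the slope has one degree less than the polynomial and cannot be enlarged, so each step
    -- costs one degree.
    exp-growth : ∀ k → (1ℚ + t) * exp k x ≤ exp (suc k) (x + t)
    exp-growth k = begin
      (1ℚ + t) * exp k x            ≡⟨ solve 2 (λ t e → (con 1ℚ :+ t) :* e := e :+ t :* e) refl t (exp k x) ⟩
      exp k x + t * exp k x         ≤⟨ +-monoˡ-≤ _ (exp-step k 0≤x) ⟩
      exp (suc k) x + t * exp k x   ≤⟨ exp-+-lower k ⟩
      exp (suc k) (x + t)           ∎

  ι-suc-* : ∀ j t → ι (suc j) * t ≡ ι j * t + t
  ι-suc-* j t = trans (cong (_* t) (ι-+ 1 j))
    (solve 2 (λ j t → (con 1ℚ :+ j) :* t := j :* t :+ t) refl (ι j) t)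

  -- The truncated form of `(1 − t) ^ j ≤ exp (− j t)`: the polynomial is led back from `j t` to 0
  -- by `j` uses of `exp-decay`.
  ^-exp≤1 : ∀ {t} k j → 0ℚ ≤ t → t ≤ 1ℚ → (1ℚ - t) ^ j * exp k (ι j * t) ≤ 1ℚ
  ^-exp≤1 {t} k zero 0≤t t≤1 = begin
    1ℚ * exp k (0ℚ * t)  ≡⟨ trans (*-identityˡ _) (cong (exp k) (*-zeroˡ t)) ⟩
    exp k 0ℚ             ≤⟨ exp-0 k ⟩
    1ℚ                   ∎
    where
    open ≤-Reasoning
    exp-0 : ∀ k → exp k 0ℚ ≤ 1ℚ
    exp-0 zero          = 0≤1
    exp-0 (suc zero)    = ≤-refl
    exp-0 (suc (suc k)) = ≤-trans (≤-reflexive (trans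
      (cong (exp (suc k) 0ℚ +_) (trans (cong (_* 1/! (suc k)) (*-zeroˡ (0ℚ ^ k))) (*-zeroˡ (1/! (suc k)))))
      (+-identityʳ _))) (exp-0 (suc k))
  ^-exp≤1 {t} k (suc j) 0≤t t≤1 = begin
    (1ℚ - t) * (1ℚ - t) ^ j * exp k (ι (suc j) * t)
      ≡⟨ cong (λ y → (1ℚ - t) * (1ℚ - t) ^ j * exp k y) (ι-suc-* j t) ⟩
    (1ℚ - t) * (1ℚ - t) ^ j * exp k (ι j * t + t)
      ≡⟨ solve 3 (λ a b c → a :* b :* c := b :* (a :* c)) refl (1ℚ - t) ((1ℚ - t) ^ j) _ ⟩
    (1ℚ - t) ^ j * ((1ℚ - t) * exp k (ι j * t + t))
      ≤⟨ *-monoˡ (0≤^ j (≤⇒0≤- t≤1)) (exp-decay (0≤* (0≤ι j) 0≤t) 0≤t k) ⟩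
    (1ℚ - t) ^ j * exp k (ι j * t)
      ≤⟨ ^-exp≤1 k j 0≤t t≤1 ⟩
    1ℚ ∎
    where open ≤-Reasoning

  -- The reverse bound, with `q = 1 / (1 + t)`. The `j` uses of `exp-growth` account for `j` in the
  -- degree; the further `suc k` leaves a positive degree at the start, where `exp 0` would be the
  -- empty sum.
  1≤^-exp : ∀ {q t} k j → 0ℚ ≤ q → 0ℚ ≤ t → q * (1ℚ + t) ≡ 1ℚ → 1ℚ ≤ q ^ j * exp (j ℕ.+ suc k) (ι j * t)
  1≤^-exp {q} {t} k zero 0≤q 0≤t eq = ≤-trans (1≤exp k (0≤* (0≤ι 0) 0≤t)) (≤-reflexive (sym (*-identityˡ _)))
  1≤^-exp {q} {t} k (suc j) 0≤q 0≤t eq = begin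
    1ℚ
      ≤⟨ 1≤^-exp k j 0≤q 0≤t eq ⟩
    q ^ j * e
      ≡⟨ cong (q ^ j *_) (*-identityˡ e) ⟨
    q ^ j * (1ℚ * e)
      ≡⟨ cong (λ y → q ^ j * (y * e)) eq ⟨
    q ^ j * (q * (1ℚ + t) * e)
      ≡⟨ solve 4 (λ p q s e → p :* (q :* s :* e) := q :* p :* (s :* e)) refl (q ^ j) q (1ℚ + t) e ⟩
    q * q ^ j * ((1ℚ + t) * e)
      ≤⟨ *-monoˡ (0≤^ (suc j) 0≤q) (exp-growth (0≤* (0≤ι j) 0≤t) 0≤t (j ℕ.+ suc k)) ⟩
    q * q ^ j * exp (suc (j ℕ.+ suc k)) (ι j * t + t)
      ≡⟨ cong (λ y → q * q ^ j * exp (suc (j ℕ.+ suc k)) y) (ι-suc-* j t) ⟨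
    q * q ^ j * exp (suc (j ℕ.+ suc k)) (ι (suc j) * t) ∎
    where
    open ≤-Reasoning
    e = exp (j ℕ.+ suc k) (ι j * t)

  -- Ratios of binomial coefficients as powers of `1 − 1/m`.

  -- The ratio `1 − n / (M + 1)` is at most `1 − 1/n` when `M + 1 ≤ n²`. Multiplying by `suc M`
  -- brings in `absorption`, and adding a common term avoids subtraction in ℕ;
  -- `binomial-ratio-lower` works in the same way.
  binomial-ratio-upper : ∀ k M → suc M ℕ.≤ suc k ℕ.* suc k →
    suc k ℕ.* (M C suc k) ℕ.≤ k ℕ.* (suc M C suc k)
  binomial-ratio-upper k M M<n² = ℕₚ.*-cancelˡ-≤ (suc M) (ℕₚ.+-cancelʳ-≤ (n ℕ.* n ℕ.* b) _ _ (begin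
    suc M ℕ.* (n ℕ.* a) ℕ.+ n ℕ.* n ℕ.* b
      ≡⟨ ℕ-solve 4 (λ m n a b → m ⊗ (n ⊗ a) ⊕ n ⊗ n ⊗ b ⊜ n ⊗ (m ⊗ a ⊕ n ⊗ b)) refl (suc M) n a b ⟩
    n ℕ.* (suc M ℕ.* a ℕ.+ n ℕ.* b)
      ≡⟨ cong (n ℕ.*_) (absorption M n) ⟩
    n ℕ.* (suc M ℕ.* b)
      ≡⟨ ℕ-solve 3 (λ m k b → (κ 1 ⊕ k) ⊗ (m ⊗ b) ⊜ m ⊗ (k ⊗ b) ⊕ m ⊗ b) refl (suc M) k b ⟩
    suc M ℕ.* (k ℕ.* b) ℕ.+ suc M ℕ.* b
      ≤⟨ ℕₚ.+-monoʳ-≤ (suc M ℕ.* (k ℕ.* b)) (ℕₚ.*-monoˡ-≤ b M<n²) ⟩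
    suc M ℕ.* (k ℕ.* b) ℕ.+ n ℕ.* n ℕ.* b ∎))
    where
    open ℕₚ.≤-Reasoning
    open ℕ-Solver.+-*-Solver using () renaming (solve to ℕ-solve; _:+_ to _⊕_; _:*_ to _⊗_; _:=_ to _⊜_; con to κ)
    n = suc k
    a = M C n
    b = suc M C n

  binomial-ratio-lower : ∀ n l M → n ℕ.* suc l ℕ.≤ suc M → l ℕ.* (suc M C n) ℕ.≤ suc l ℕ.* (M C n)
  binomial-ratio-lower n l M nm≤M = ℕₚ.*-cancelˡ-≤ (suc M) (ℕₚ.+-cancelʳ-≤ (n ℕ.* suc l ℕ.* b) _ _ (begin
    suc M ℕ.* (l ℕ.* b) ℕ.+ n ℕ.* suc l ℕ.* b
      ≤⟨ ℕₚ.+-monoʳ-≤ (suc M ℕ.* (l ℕ.* b)) (ℕₚ.*-monoˡ-≤ b nm≤M) ⟩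
    suc M ℕ.* (l ℕ.* b) ℕ.+ suc M ℕ.* b
      ≡⟨ ℕ-solve 3 (λ m l b → m ⊗ (l ⊗ b) ⊕ m ⊗ b ⊜ (κ 1 ⊕ l) ⊗ (m ⊗ b)) refl (suc M) l b ⟩
    suc l ℕ.* (suc M ℕ.* b)
      ≡⟨ cong (suc l ℕ.*_) (absorption M n) ⟨
    suc l ℕ.* (suc M ℕ.* a ℕ.+ n ℕ.* b)
      ≡⟨ ℕ-solve 5 (λ m l n a b → l ⊗ (m ⊗ a ⊕ n ⊗ b) ⊜ m ⊗ (l ⊗ a) ⊕ n ⊗ l ⊗ b) refl (suc M) (suc l) n a b ⟩
    suc M ℕ.* (suc l ℕ.* a) ℕ.+ n ℕ.* suc l ℕ.* b ∎))
    where
    open ℕₚ.≤-Reasoning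
    open ℕ-Solver.+-*-Solver using () renaming (solve to ℕ-solve; _:+_ to _⊕_; _:*_ to _⊗_; _:=_ to _⊜_; con to κ)
    a = M C n
    b = suc M C n


  -- Shifted by one, so that no NonZero argument is needed.
  inv : ℕ → ℚ
  inv l = ℤ.+ 1 / suc l

  inv-* : ∀ l → inv l * ι (suc l) ≡ 1ℚ
  inv-* l = /-*-cancel 1 (suc l)

  0≤inv : ∀ l → 0ℚ ≤ inv l
  0≤inv l = <⇒≤ (1/-pos (suc l))

  inv≤1 : ∀ l → inv l ≤ 1ℚ
  inv≤1 l = 1/-anti 1 (suc l) (s≤s z≤n)

  1-inv : ∀ l → (1ℚ - inv l) * ι (suc l) ≡ ι l
  1-inv l = begin-equality
    (1ℚ - t) * ι (suc l)        ≡⟨ solve 2 (λ t m → (con 1ℚ :- t) :* m := m :- t :* m) refl t (ι (suc l)) ⟩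
    ι (suc l) - t * ι (suc l)   ≡⟨ cong₂ _-_ (ι-+ 1 l) (inv-* l) ⟩
    1ℚ + ι l - 1ℚ               ≡⟨ solve 1 (λ l → con 1ℚ :+ l :- con 1ℚ := l) refl (ι l) ⟩
    ι l                         ∎
    where
    open ≤-Reasoning
    t = inv l

  inv-suc-* : ∀ l p → inv l * (ι (suc l) * p) ≡ p
  inv-suc-* l p = trans (sym (*-assoc (inv l) (ι (suc l)) p)) (trans (cong (_* p) (inv-* l)) (*-identityˡ p))

  inv-l-* : ∀ l p → inv l * (ι l * p) ≡ (1ℚ - inv l) * p
  inv-l-* l p = begin-equality
    inv l * (ι l * p)                        ≡⟨ cong (λ y → inv l * (y * p)) (1-inv l) ⟨
    inv l * ((1ℚ - inv l) * ι (suc l) * p)   ≡⟨ solve 4 (λ t q m p → t :* (q :* m :* p) := t :* (m :* (q :* p))) refl (inv l) (1ℚ - inv l) (ι (suc l)) p ⟩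
    inv l * (ι (suc l) * ((1ℚ - inv l) * p)) ≡⟨ inv-suc-* l _ ⟩
    (1ℚ - inv l) * p                         ∎
    where open ≤-Reasoning

  ι-ratio-upper : ∀ l a b → suc l ℕ.* a ℕ.≤ l ℕ.* b → ι a ≤ (1ℚ - inv l) * ι b
  ι-ratio-upper l a b h = begin
    ι a                        ≡⟨ inv-suc-* l (ι a) ⟨
    inv l * (ι (suc l) * ι a)  ≡⟨ cong (inv l *_) (ι-* (suc l) a) ⟨
    inv l * ι (suc l ℕ.* a)    ≤⟨ *-monoˡ (0≤inv l) (ι-mono h) ⟩
    inv l * ι (l ℕ.* b)        ≡⟨ cong (inv l *_) (ι-* l b) ⟩
    inv l * (ι l * ι b)        ≡⟨ inv-l-* l (ι b) ⟩
    (1ℚ - inv l) * ι b         ∎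
    where open ≤-Reasoning

  ι-ratio-lower : ∀ l a b → l ℕ.* b ℕ.≤ suc l ℕ.* a → (1ℚ - inv l) * ι b ≤ ι a
  ι-ratio-lower l a b h = begin
    (1ℚ - inv l) * ι b         ≡⟨ inv-l-* l (ι b) ⟨
    inv l * (ι l * ι b)        ≡⟨ cong (inv l *_) (ι-* l b) ⟨
    inv l * ι (l ℕ.* b)        ≤⟨ *-monoˡ (0≤inv l) (ι-mono h) ⟩
    inv l * ι (suc l ℕ.* a)    ≡⟨ cong (inv l *_) (ι-* (suc l) a) ⟩
    inv l * (ι (suc l) * ι a)  ≡⟨ inv-suc-* l (ι a) ⟩
    ι a                        ∎
    where open ≤-Reasoning

  0≤1-inv : ∀ l → 0ℚ ≤ 1ℚ - inv l
  0≤1-inv l = ≤⇒0≤- (inv≤1 l)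

  1-inv≤1 : ∀ l → 1ℚ - inv l ≤ 1ℚ
  1-inv≤1 l = ≤-by (inv l) (0≤inv l) (solve 1 (λ t → con 1ℚ := con 1ℚ :- t :+ t) refl (inv l))

  avoid-upper : ∀ k A → let n = suc k in
    ι ((n ℕ.* n ∸ A) C n) ≤ (1ℚ - inv k) ^ A * ι ((n ℕ.* n) C n)
  avoid-upper k zero    = ≤-reflexive (sym (*-identityˡ _))
  avoid-upper k (suc A) = begin
    ι ((N ∸ suc A) C n)          ≤⟨ step (N ∸ A) (N ∸ suc A) (ℕₚ.m∸n≤m N A) (sym (ℕₚ.pred[m∸n]≡m∸[1+n] N A)) ⟩
    q * ι ((N ∸ A) C n)          ≤⟨ *-monoˡ (0≤1-inv k) (avoid-upper k A) ⟩
    q * (q ^ A * ι (N C n))      ≡⟨ *-assoc q _ _ ⟨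
    q ^ suc A * ι (N C n)        ∎
    where
    open ≤-Reasoning
    n = suc k
    N = n ℕ.* n
    q = 1ℚ - inv k
    step : ∀ M M′ → M ℕ.≤ N → M′ ≡ ℕ.pred M → ι (M′ C n) ≤ q * ι (M C n)
    -- Reached once `A` is at least `N` and truncated subtraction stays at zero; both binomials
    -- vanish since `n` is positive.
    step zero    _ _   refl = ≤-reflexive (sym (*-zeroʳ q))
    step (suc M) _ M≤N refl = ι-ratio-upper k (M C n) (suc M C n) (binomial-ratio-upper k M M≤N)

  avoid-lower : ∀ n l N A → n ℕ.* suc l ℕ.+ A ℕ.≤ N →
    (1ℚ - inv l) ^ A * ι (N C n) ≤ ι ((N ∸ A) C n)
  avoid-lower n l N zero    _ = ≤-reflexive (*-identityˡ _)
  avoid-lower n l N (suc A) h = begin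
    q ^ suc A * ι (N C n)        ≡⟨ *-assoc q _ _ ⟩
    q * (q ^ A * ι (N C n))      ≤⟨ *-monoˡ (0≤1-inv l) (avoid-lower n l N A (ℕₚ.≤-trans (ℕₚ.+-monoʳ-≤ (n ℕ.* suc l) (ℕₚ.n≤1+n A)) h)) ⟩
    q * ι ((N ∸ A) C n)          ≤⟨ step (N ∸ A) (N ∸ suc A) nm<N∸A (sym (ℕₚ.pred[m∸n]≡m∸[1+n] N A)) ⟩
    ι ((N ∸ suc A) C n)          ∎
    where
    open ≤-Reasoning
    q = 1ℚ - inv l
    nm<N∸A : n ℕ.* suc l ℕ.< N ∸ A
    nm<N∸A = ℕₚ.m+n≤o⇒m≤o∸n (suc (n ℕ.* suc l)) (subst (ℕ._≤ N) (ℕₚ.+-suc (n ℕ.* suc l) A) h)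
    step : ∀ M M′ → n ℕ.* suc l ℕ.< M → M′ ≡ ℕ.pred M → q * ι (M C n) ≤ ι (M′ C n)
    step (suc M) _ nm<M refl = ι-ratio-lower l (M C n) (suc M C n) (binomial-ratio-lower n l M (ℕₚ.<⇒≤ nm<M))

  ι-sum : ∀ {n} (f : Fin n → ℕ) → ι (sumℕ f) ≡ sum (ι ∘ f)
  ι-sum {zero}  f = refl
  ι-sum {suc n} f = trans (ι-+ (f zero) _) (cong (ι (f zero) +_) (ι-sum (f ∘ suc)))

  -- The sum of `w ^ depth` over the board.

  depthSum : ℚ → ℕ → ℚ
  depthSum w n = ∑[ x < n ] ∑[ y < n ] (w ^ depth n (toℕ x) (toℕ y))

  ∑-frame : ∀ n (f : ℕ → ℚ) → ∑[ i < suc (suc n) ] f (toℕ i) ≡ f 0 + (∑[ i < n ] f (suc (toℕ i)) + f (suc n))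
  ∑-frame n f = cong (f 0 +_) (∑-last n (f ∘ suc))

  -- The border has 4 (n + 1) spaces, and removing it lowers every depth by one.
  depthSum-step : ∀ w n → depthSum w (suc (suc n)) ≡ ι 4 * (ι n + 1ℚ) + w * depthSum w n
  depthSum-step w n = begin-equality
    depthSum w m
      ≡⟨ ∑-frame n row ⟩
    row 0 + (∑[ i < n ] row (suc (toℕ i)) + row (suc n))
      ≡⟨ cong₂ (λ a b → a + (∑[ i < n ] row (suc (toℕ i)) + b)) (border 0 (λ _ → refl)) (border (suc n) last-row) ⟩
    ι m + (∑[ i < n ] row (suc (toℕ i)) + ι m)
      ≡⟨ cong (λ s → ι m + (s + ι m)) (sum-cong-≗ {n} (λ i → inner-row (toℕ i) (toℕ<n i))) ⟩
    ι m + (∑[ i < n ] (1ℚ + (w * inner (toℕ i) + 1ℚ)) + ι m)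
      ≡⟨ cong (λ s → ι m + (s + ι m)) sum-inner ⟩
    ι m + (ι n * 1ℚ + (w * depthSum w n + ι n * 1ℚ) + ι m)
      ≡⟨ cong (λ z → z + (ι n * 1ℚ + (w * depthSum w n + ι n * 1ℚ) + z)) (ι-+ 2 n) ⟩
    ι 2 + ι n + (ι n * 1ℚ + (w * depthSum w n + ι n * 1ℚ) + (ι 2 + ι n))
      ≡⟨ solve 2 (λ n s → con (ι 2) :+ n :+ (n :* con 1ℚ :+ (s :+ n :* con 1ℚ) :+ (con (ι 2) :+ n)) :=
           con (ι 4) :* (n :+ con 1ℚ) :+ s) refl (ι n) (w * depthSum w n) ⟩
    ι 4 * (ι n + 1ℚ) + w * depthSum w n ∎
    where
    open ≤-Reasoning
    m = suc (suc n)
    cell : ℕ → ℕ → ℚ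
    cell x y = w ^ depth m x y
    row : ℕ → ℚ
    row x = ∑[ y < m ] cell x (toℕ y)
    inner : ℕ → ℚ
    inner x = ∑[ y < n ] (w ^ depth n x (toℕ y))
    border : ∀ x → (∀ y → depth m x y ≡ 0) → row x ≡ ι m
    border x d≡0 = trans (sum-cong-≗ {m} (λ y → cong (w ^_) (d≡0 (toℕ y)))) (trans (∑-const m 1ℚ) (*-identityʳ (ι m)))
    last-row : ∀ y → depth m (suc n) y ≡ 0
    last-row y = cong (λ z → (suc n ℕ.⊓ z) ℕ.⊓ (y ℕ.⊓ (m ∸ suc y))) (ℕₚ.n∸n≡0 n)
    last-column : ∀ x → depth m x (suc n) ≡ 0
    last-column x = trans (cong (λ z → (x ℕ.⊓ (m ∸ suc x)) ℕ.⊓ (suc n ℕ.⊓ z)) (ℕₚ.n∸n≡0 n)) (ℕₚ.⊓-zeroʳ (x ℕ.⊓ (m ∸ suc x)))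
    ∸-suc : ∀ {i} → i ℕ.< n → n ∸ i ≡ suc (n ∸ suc i)
    ∸-suc i<n = ℕₚ.+-∸-assoc 1 i<n
    depth-inner : ∀ {x y} → x ℕ.< n → y ℕ.< n → depth m (suc x) (suc y) ≡ suc (depth n x y)
    depth-inner {x} {y} x<n y<n = cong₂ (λ a b → (suc x ℕ.⊓ a) ℕ.⊓ (suc y ℕ.⊓ b)) (∸-suc x<n) (∸-suc y<n)
    inner-row : ∀ x → x ℕ.< n → row (suc x) ≡ 1ℚ + (w * inner x + 1ℚ)
    inner-row x x<n = trans (∑-frame n (cell (suc x))) (cong₂ _+_
      (cong (w ^_) (ℕₚ.⊓-zeroʳ (suc x ℕ.⊓ (n ∸ x))))
      (cong₂ _+_
        (trans (sum-cong-≗ {n} (λ y → cong (w ^_) (depth-inner x<n (toℕ<n y))))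
          (sym (*-distribˡ-sum {n} w (λ y → w ^ depth n x (toℕ y)))))
        (cong (w ^_) (last-column (suc x)))))
    sum-inner : ∑[ i < n ] (1ℚ + (w * inner (toℕ i) + 1ℚ)) ≡ ι n * 1ℚ + (w * depthSum w n + ι n * 1ℚ)
    sum-inner = trans (∑-distrib-+ {n} (λ _ → 1ℚ) _) (cong₂ _+_ (∑-const n 1ℚ)
      (trans (∑-distrib-+ {n} (λ i → w * inner (toℕ i)) (λ _ → 1ℚ)) (cong₂ _+_
        (sym (*-distribˡ-sum {n} w (λ i → inner (toℕ i)))) (∑-const n 1ℚ))))

  -- With D = 1 − q², the recursion for depthSum (q * q) has the solutions
  -- envelope q g n / D², where g depends only on the parity of n.
  envelope : ℚ → ℚ → ℕ → ℚ
  envelope q g n = ι 4 * (1ℚ - q * q) * (ι n + 1ℚ) - ι 8 + g * q ^ n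

  envelope-step : ∀ q g n → let D = 1ℚ - q * q in
    envelope q g (suc (suc n)) ≡ D * D * (ι 4 * (ι n + 1ℚ)) + q * q * envelope q g n
  envelope-step q g n = trans
    (cong (λ m → ι 4 * (1ℚ - q * q) * (m + 1ℚ) - ι 8 + g * q ^ suc (suc n)) (ι-+ 2 n))
    (solve 4 (λ q g n p → con (ι 4) :* (con 1ℚ :- q :* q) :* (con (ι 2) :+ n :+ con 1ℚ) :- con (ι 8) :+ g :* (q :* (q :* p)) :=
       (con 1ℚ :- q :* q) :* (con 1ℚ :- q :* q) :* (con (ι 4) :* (n :+ con 1ℚ)) :+
       q :* q :* (con (ι 4) :* (con 1ℚ :- q :* q) :* (n :+ con 1ℚ) :- con (ι 8) :+ g :* p)) refl q g (ι n) (q ^ n))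

  D²depthSum-step : ∀ q n → let D = 1ℚ - q * q in
    D * D * depthSum (q * q) (suc (suc n)) ≡ D * D * (ι 4 * (ι n + 1ℚ)) + q * q * (D * D * depthSum (q * q) n)
  D²depthSum-step q n = trans (cong (λ s → D * D * s) (depthSum-step (q * q) n))
    (solve 4 (λ d a w s → d :* (a :+ w :* s) := d :* a :+ w :* (d :* s)) refl (D * D) (ι 4 * (ι n + 1ℚ)) (q * q) (depthSum (q * q) n))
    where D = 1ℚ - q * q

  -- Two steps multiply the gap between the sides by `q²`, so `n = 0` and `n = 1` decide. With
  -- `g = 8` the gaps there are `4 D` and `(1 − q)(7 q − 1 + q² + q³)`; `½ ≤ q` gives the sign of
  -- the second.
  depthSum-upper : ∀ {q} n → ½ ≤ q → q ≤ 1ℚ → let D = 1ℚ - q * q in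
    D * D * depthSum (q * q) n ≤ envelope q (ι 8) n
  depthSum-upper {q} zero ½≤q q≤1 = ≤-by (ι 4 * (1ℚ - q * q)) (0≤* (0≤ι 4) (≤⇒0≤- (*-mono 0≤q 0≤1 q≤1 q≤1)))
    (solve 1 (λ q → con (ι 4) :* (con 1ℚ :- q :* q) :* (con 0ℚ :+ con 1ℚ) :- con (ι 8) :+ con (ι 8) :* con 1ℚ :=
      (con 1ℚ :- q :* q) :* (con 1ℚ :- q :* q) :* con 0ℚ :+ con (ι 4) :* (con 1ℚ :- q :* q)) refl q)
    where
    0≤q = ≤-trans {0ℚ} {½} (<⇒≤ 0<½) ½≤q
  depthSum-upper {q} (suc zero) ½≤q q≤1 = ≤-by ((1ℚ - q) * (ι 7 * (q - ½) + (ι 5 * ½ + q * q + q * q * q)))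
    (0≤* (≤⇒0≤- q≤1) (0≤+ (0≤* (0≤ι 7) (≤⇒0≤- ½≤q)) (0≤+ (0≤+ (0≤* (0≤ι 5) 0≤½) (0≤* 0≤q 0≤q)) (0≤* (0≤* 0≤q 0≤q) 0≤q))))
    (solve 1 (λ q → con (ι 4) :* (con 1ℚ :- q :* q) :* (con 1ℚ :+ con 1ℚ) :- con (ι 8) :+ con (ι 8) :* (q :* con 1ℚ) :=
      (con 1ℚ :- q :* q) :* (con 1ℚ :- q :* q) :* con 1ℚ :+
      (con 1ℚ :- q) :* (con (ι 7) :* (q :- con ½) :+ (con (ι 5) :* con ½ :+ q :* q :+ q :* q :* q))) refl q)
    where
    0≤½ = <⇒≤ 0<½
    0≤q = ≤-trans {0ℚ} {½} 0≤½ ½≤q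
  depthSum-upper {q} (suc (suc n)) ½≤q q≤1 = begin
    D * D * depthSum (q * q) (suc (suc n))
      ≡⟨ D²depthSum-step q n ⟩
    D * D * (ι 4 * (ι n + 1ℚ)) + q * q * (D * D * depthSum (q * q) n)
      ≤⟨ +-monoʳ-≤ (D * D * (ι 4 * (ι n + 1ℚ))) (*-monoˡ (0≤* 0≤q 0≤q) (depthSum-upper n ½≤q q≤1)) ⟩
    D * D * (ι 4 * (ι n + 1ℚ)) + q * q * envelope q (ι 8) n
      ≡⟨ envelope-step q (ι 8) n ⟨
    envelope q (ι 8) (suc (suc n)) ∎
    where
    open ≤-Reasoning
    D = 1ℚ - q * q
    0≤q = ≤-trans {0ℚ} {½} (<⇒≤ 0<½) ½≤q

  -- The value `g = 8 − 4 D` is exact for even `n`, as it makes the envelope vanish at 0. At `n = 1`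
  -- the gap is `(1 − q)⁴`.
  depthSum-lower : ∀ {q} n → 0ℚ ≤ q → q ≤ 1ℚ → let D = 1ℚ - q * q in
    envelope q (ι 8 - ι 4 * D) n ≤ D * D * depthSum (q * q) n
  depthSum-lower {q} zero 0≤q q≤1 = ≤-reflexive
    (solve 1 (λ q → con (ι 4) :* (con 1ℚ :- q :* q) :* (con 0ℚ :+ con 1ℚ) :- con (ι 8) :+
         (con (ι 8) :- con (ι 4) :* (con 1ℚ :- q :* q)) :* con 1ℚ :=
      (con 1ℚ :- q :* q) :* (con 1ℚ :- q :* q) :* con 0ℚ) refl q)
  depthSum-lower {q} (suc zero) 0≤q q≤1 = ≤-by ((1ℚ - q) * (1ℚ - q) * ((1ℚ - q) * (1ℚ - q)))
    (0≤* (0≤* 0≤s 0≤s) (0≤* 0≤s 0≤s))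
    (solve 1 (λ q → (con 1ℚ :- q :* q) :* (con 1ℚ :- q :* q) :* con 1ℚ :=
      con (ι 4) :* (con 1ℚ :- q :* q) :* (con 1ℚ :+ con 1ℚ) :- con (ι 8) :+
        (con (ι 8) :- con (ι 4) :* (con 1ℚ :- q :* q)) :* (q :* con 1ℚ) :+
      (con 1ℚ :- q) :* (con 1ℚ :- q) :* ((con 1ℚ :- q) :* (con 1ℚ :- q))) refl q)
    where
    0≤s = ≤⇒0≤- q≤1
  depthSum-lower {q} (suc (suc n)) 0≤q q≤1 = begin
    envelope q g (suc (suc n))
      ≡⟨ envelope-step q g n ⟩
    D * D * (ι 4 * (ι n + 1ℚ)) + q * q * envelope q g n
      ≤⟨ +-monoʳ-≤ (D * D * (ι 4 * (ι n + 1ℚ))) (*-monoˡ (0≤* 0≤q 0≤q) (depthSum-lower n 0≤q q≤1)) ⟩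
    D * D * (ι 4 * (ι n + 1ℚ)) + q * q * (D * D * depthSum (q * q) n)
      ≡⟨ D²depthSum-step q n ⟨
    D * D * depthSum (q * q) (suc (suc n)) ∎
    where
    open ≤-Reasoning
    D = 1ℚ - q * q
    g = ι 8 - ι 4 * D

  -- Two-sided bounds for the expected number of safe spaces.

  ∑∑-reach : ∀ q n c → ∑[ x < n ] ∑[ y < n ] (q ^ reach n (toℕ x) (toℕ y) * c) ≡
    q ^ (3 ℕ.* n ∸ 2) * depthSum (q * q) n * c
  ∑∑-reach q n c = begin-equality
    ∑[ x < n ] ∑[ y < n ] (q ^ reach n (toℕ x) (toℕ y) * c)
      ≡⟨ sum-cong-≗ {n} (λ x → sum-cong-≗ {n} (λ y → split (depth n (toℕ x) (toℕ y)))) ⟩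
    ∑[ x < n ] ∑[ y < n ] (p * c * (q * q) ^ depth n (toℕ x) (toℕ y))
      ≡⟨ sum-cong-≗ {n} (λ x → sym (*-distribˡ-sum {n} (p * c) (λ y → (q * q) ^ depth n (toℕ x) (toℕ y)))) ⟩
    ∑[ x < n ] (p * c * ∑[ y < n ] ((q * q) ^ depth n (toℕ x) (toℕ y)))
      ≡⟨ *-distribˡ-sum {n} (p * c) (λ x → ∑[ y < n ] ((q * q) ^ depth n (toℕ x) (toℕ y))) ⟨
    p * c * depthSum (q * q) n
      ≡⟨ solve 3 (λ p c s → p :* c :* s := p :* s :* c) refl p c (depthSum (q * q) n) ⟩
    p * depthSum (q * q) n * c ∎
    where
    open ≤-Reasoning
    p = q ^ (3 ℕ.* n ∸ 2)
    q*q : q * q ≡ q ^ 2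
    q*q = cong (q *_) (sym (*-identityʳ q))
    split : ∀ d → q ^ (3 ℕ.* n ∸ 2 ℕ.+ 2 ℕ.* d) * c ≡ p * c * (q * q) ^ d
    split d = begin-equality
      q ^ (3 ℕ.* n ∸ 2 ℕ.+ 2 ℕ.* d) * c  ≡⟨ cong (_* c) (^-homo-* q (3 ℕ.* n ∸ 2) (2 ℕ.* d)) ⟩
      p * q ^ (2 ℕ.* d) * c              ≡⟨ cong (λ z → p * z * c) (^-assocʳ q 2 d) ⟨
      p * (q ^ 2) ^ d * c                ≡⟨ cong (λ z → p * z ^ d * c) q*q ⟨
      p * (q * q) ^ d * c                ≡⟨ solve 3 (λ p s c → p :* s :* c := p :* c :* s) refl p ((q * q) ^ d) c ⟩
      p * c * (q * q) ^ d                ∎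

  𝔼S-* : ∀ n → 𝔼S n * ι ((n ℕ.* n) C n) ≡
    ∑[ x < n ] ∑[ y < n ] ι ((n ℕ.* n ∸ reach n (toℕ x) (toℕ y)) C n)
  𝔼S-* n = begin-equality
    𝔼S n * ι ((n ℕ.* n) C n)
      ≡⟨ cong (λ c → 𝔼S n * ι c) (length-placements n) ⟨
    𝔼S n * ι (length (placements n))
      ≡⟨ /-*-cancel (sumᴸ (map (safeCount n) (placements n))) (length (placements n)) {{placements-nonEmpty n}} ⟩
    ι (sumᴸ (map (safeCount n) (placements n)))
      ≡⟨ cong ι (total-safe n) ⟩
    ι (sumℕ {n} (λ x → sumℕ {n} (λ y → (n ℕ.* n ∸ reach n (toℕ x) (toℕ y)) C n)))
      ≡⟨ trans (ι-sum {n} _) (sum-cong-≗ {n} (λ x → ι-sum {n} _)) ⟩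
    ∑[ x < n ] ∑[ y < n ] ι ((n ℕ.* n ∸ reach n (toℕ x) (toℕ y)) C n) ∎
    where open ≤-Reasoning

  0<placements : ∀ n → 0ℚ < ι ((n ℕ.* n) C n)
  0<placements n = subst (λ c → 0ℚ < ι c) (length-placements n)
    (positive⁻¹ _ {{normalize-pos (length (placements n)) 1 {{_}} {{placements-nonEmpty n}}}})

  𝔼S-upper : ∀ k → let n = suc k ; q = 1ℚ - inv k in
    𝔼S n ≤ q ^ (3 ℕ.* n ∸ 2) * depthSum (q * q) n
  𝔼S-upper k = *-cancelʳ-≤-pos (ι (n ℕ.* n C n)) {{positive (0<placements n)}} (begin
    𝔼S n * ι ((n ℕ.* n) C n)
      ≡⟨ 𝔼S-* n ⟩
    ∑[ x < n ] ∑[ y < n ] ι ((n ℕ.* n ∸ reach n (toℕ x) (toℕ y)) C n)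
      ≤⟨ ∑-mono {n} (λ x → ∑-mono {n} (λ y → avoid-upper k (reach n (toℕ x) (toℕ y)))) ⟩
    ∑[ x < n ] ∑[ y < n ] (q ^ reach n (toℕ x) (toℕ y) * ι ((n ℕ.* n) C n))
      ≡⟨ ∑∑-reach q n (ι ((n ℕ.* n) C n)) ⟩
    q ^ (3 ℕ.* n ∸ 2) * depthSum (q * q) n * ι ((n ℕ.* n) C n) ∎)
    where
    open ≤-Reasoning
    n = suc k
    q = 1ℚ - inv k

  reach≤4n : ∀ {n} (x y : Fin n) → reach n (toℕ x) (toℕ y) ℕ.≤ 4 ℕ.* n
  reach≤4n {n} x y = begin
    3 ℕ.* n ∸ 2 ℕ.+ 2 ℕ.* depth n (toℕ x) (toℕ y)
      ≤⟨ ℕₚ.+-mono-≤ (ℕₚ.m∸n≤m (3 ℕ.* n) 2) 2d≤n ⟩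
    3 ℕ.* n ℕ.+ n
      ≡⟨ ℕₚ.+-comm (3 ℕ.* n) n ⟩
    4 ℕ.* n ∎
    where
    open ℕₚ.≤-Reasoning
    a = toℕ x
    d = depth n a (toℕ y)
    d≤ : d ℕ.≤ a ℕ.⊓ (n ∸ suc a)
    d≤ = ℕₚ.m⊓n≤m _ _
    2d≤n : 2 ℕ.* d ℕ.≤ n
    2d≤n = begin
      d ℕ.+ (d ℕ.+ 0)        ≡⟨ cong (d ℕ.+_) (ℕₚ.+-identityʳ d) ⟩
      d ℕ.+ d                ≤⟨ ℕₚ.+-mono-≤ (ℕₚ.≤-trans d≤ (ℕₚ.m⊓n≤m a _)) (ℕₚ.≤-trans d≤ (ℕₚ.m⊓n≤n a _)) ⟩
      a ℕ.+ (n ∸ suc a)      ≤⟨ ℕₚ.n≤1+n _ ⟩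
      suc a ℕ.+ (n ∸ suc a)  ≡⟨ ℕₚ.m+[n∸m]≡n (toℕ<n x) ⟩
      n                      ∎

  -- Since `suc l` is `n − 4` and `reach` is at most `4 n`, the requirement of `avoid-lower` becomes
  -- `n (n − 4) + 4 n = n²`.
  𝔼S-lower : ∀ l → let n = 5 ℕ.+ l ; q = 1ℚ - inv l in
    q ^ (3 ℕ.* n ∸ 2) * depthSum (q * q) n ≤ 𝔼S n
  𝔼S-lower l = *-cancelʳ-≤-pos (ι (n ℕ.* n C n)) {{positive (0<placements n)}} (begin
    q ^ (3 ℕ.* n ∸ 2) * depthSum (q * q) n * ι ((n ℕ.* n) C n)
      ≡⟨ ∑∑-reach q n (ι ((n ℕ.* n) C n)) ⟨
    ∑[ x < n ] ∑[ y < n ] (q ^ reach n (toℕ x) (toℕ y) * ι ((n ℕ.* n) C n))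
      ≤⟨ ∑-mono {n} (λ x → ∑-mono {n} (λ y → avoid-lower n l (n ℕ.* n) (reach n (toℕ x) (toℕ y)) (room x y))) ⟩
    ∑[ x < n ] ∑[ y < n ] ι ((n ℕ.* n ∸ reach n (toℕ x) (toℕ y)) C n)
      ≡⟨ 𝔼S-* n ⟨
    𝔼S n * ι ((n ℕ.* n) C n) ∎)
    where
    open ≤-Reasoning
    n = 5 ℕ.+ l
    q = 1ℚ - inv l
    room : ∀ x y → n ℕ.* suc l ℕ.+ reach n (toℕ x) (toℕ y) ℕ.≤ n ℕ.* n
    room x y = ℕₚ.≤-trans (ℕₚ.+-monoʳ-≤ (n ℕ.* suc l) (reach≤4n x y)) (ℕₚ.≤-reflexive
      (trans (cong (n ℕ.* suc l ℕ.+_) (ℕₚ.*-comm 4 n))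
        (trans (sym (ℕₚ.*-distribˡ-+ n (suc l) 4)) (cong (n ℕ.*_) (ℕₚ.+-comm (suc l) 4)))))

  -- Partial sums of `e` against powers of `1 − 1/m`.

  ι-*-inv : ∀ l → ι (suc l) * inv l ≡ 1ℚ
  ι-*-inv l = trans (*-comm (ι (suc l)) (inv l)) (inv-* l)

  -- With `e-lower`, the classical `(1 − 1/m) ^ m ≤ 1/e ≤ (1 − 1/m) ^ (m −
  -- 1)` for truncated `e`: steps of length `1/m` or `1/(m − 1)` lead exactly to 1. The upper bound
  -- holds for any truncation, the lower one from `m` terms on.
  e-upper : ∀ k l → (1ℚ - inv l) ^ suc l * Σ1/k! k ≤ 1ℚ
  e-upper k l = subst (λ y → (1ℚ - inv l) ^ suc l * y ≤ 1ℚ)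
    (trans (cong (exp k) (ι-*-inv l)) (exp-1 k))
    (^-exp≤1 k (suc l) (0≤inv l) (inv≤1 l))

  e-lower : ∀ k l → suc (suc l) ℕ.≤ k → 1ℚ ≤ (1ℚ - inv (suc l)) ^ suc l * Σ1/k! k
  e-lower k l l<k = begin
    1ℚ
      -- The surplus is chosen so that the final degree is exactly `k`; this is where
      -- `suc (suc l) ≤ k` enters.
      ≤⟨ 1≤^-exp (k ∸ suc (suc l)) (suc l) (0≤1-inv (suc l)) (0≤inv l) q[1+t] ⟩
    q ^ suc l * exp (suc l ℕ.+ suc (k ∸ suc (suc l))) (ι (suc l) * inv l)
      ≡⟨ cong₂ (λ j y → q ^ suc l * exp j y)
           (trans (ℕₚ.+-suc (suc l) _) (ℕₚ.m+[n∸m]≡n l<k)) (ι-*-inv l) ⟩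
    q ^ suc l * exp k 1ℚ
      ≡⟨ cong (q ^ suc l *_) (exp-1 k) ⟩
    q ^ suc l * Σ1/k! k ∎
    where
    open ≤-Reasoning
    q = 1ℚ - inv (suc l)
    q[1+t] : q * (1ℚ + inv l) ≡ 1ℚ
    q[1+t] = begin-equality
      q * (1ℚ + inv l)                       ≡⟨ cong (λ y → q * (y + inv l)) (ι-*-inv l) ⟨
      q * (ι (suc l) * inv l + inv l)        ≡⟨ cong (q *_) (ι-suc-* (suc l) (inv l)) ⟨
      q * (ι (suc (suc l)) * inv l)          ≡⟨ *-assoc q _ _ ⟨
      q * ι (suc (suc l)) * inv l            ≡⟨ cong (_* inv l) (1-inv (suc l)) ⟩
      ι (suc l) * inv l                      ≡⟨ ι-*-inv l ⟩
      1ℚ                                     ∎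

  1≤e : ∀ k → 1ℚ ≤ Σ1/k! (suc k)
  1≤e k = subst (1ℚ ≤_) (exp-1 (suc k)) (1≤exp k 0≤1)

  0≤e : ∀ k → 0ℚ ≤ Σ1/k! k
  0≤e k = subst (0ℚ ≤_) (exp-1 k) (0≤exp k 0≤1)

  -- The case `m = 2` of `e-upper`, where the power is `1/4`.
  e≤4 : ∀ k → Σ1/k! k ≤ ι 4
  e≤4 k = begin
    Σ1/k! k                             ≡⟨ solve 1 (λ e → e := con (ι 4) :* (con ((1ℚ - inv 1) ^ 2) :* e)) refl (Σ1/k! k) ⟩
    ι 4 * ((1ℚ - inv 1) ^ 2 * Σ1/k! k)  ≤⟨ *-monoˡ (0≤ι 4) (e-upper k 1) ⟩
    ι 4 * 1ℚ                            ≡⟨ *-identityʳ (ι 4) ⟩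
    ι 4                                 ∎
    where open ≤-Reasoning

  -- The normalised expectation is within `54 / (n − 4)` of 2.

  -- E[Sₙ] e⁴ / n² for n = l + 1, with e replaced by its k-th partial sum.
  normalised : ℕ → ℕ → ℚ
  normalised l k = 𝔼S (suc l) * (inv l * inv l) * Σ1/k! k ^ 4

  0≤𝔼S : ∀ n → 0ℚ ≤ 𝔼S n
  0≤𝔼S n = nonNegative⁻¹ (𝔼S n)
    {{normalize-nonNeg (sumᴸ (map (safeCount n) (placements n))) (length (placements n)) {{placements-nonEmpty n}}}}

  -- As `D = t (2 − t)`, multiplying by `(2 − t)² (1 − t)²` brings in `D²`, matching the envelope,
  -- and `q²`, which completes `q ^ (3 n − 2)` to `p ^ 3`. The powers of `p` then pair with the
  -- powers of `ê`, and `p ê ≤ 1`.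
  normalised-upper : ∀ l k → 5 ℕ.≤ l → normalised l k ≤ ι 2 + ι 54 * inv l
  -- `4 − 12 t` is the linear part of `((2 − t)(1 − t))²` and a lower bound for it; `t ≤ 1/6` keeps
  -- it at least 2.
  normalised-upper l k 5≤l = *-cancelʳ-≤-pos (ι 4 - ι 12 * t) {{positive 0<c}} (begin
    y * (ι 4 - ι 12 * t)
      ≤⟨ ≤-by (y * (t * t * (ι 7 + ι 6 * q + t * t))) (0≤* 0≤y (0≤* (0≤* 0≤t 0≤t) (0≤+ (0≤+ (0≤ι 7) (0≤* (0≤ι 6) 0≤q)) (0≤* 0≤t 0≤t))))
           (solve 2 (λ y t → y :* ((con (ι 2) :- t) :* (con (ι 2) :- t) :* ((con 1ℚ :- t) :* (con 1ℚ :- t))) :=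
              y :* (con (ι 4) :- con (ι 12) :* t) :+
              y :* (t :* t :* (con (ι 7) :+ con (ι 6) :* (con 1ℚ :- t) :+ t :* t))) refl y t) ⟩
    y * ((ι 2 - t) * (ι 2 - t) * (q * q))
      ≡⟨ solve 3 (λ E e t → E :* (t :* t) :* e :* ((con (ι 2) :- t) :* (con (ι 2) :- t) :* ((con 1ℚ :- t) :* (con 1ℚ :- t))) :=
           (con 1ℚ :- (con 1ℚ :- t) :* (con 1ℚ :- t)) :* (con 1ℚ :- (con 1ℚ :- t) :* (con 1ℚ :- t)) :*
             ((con 1ℚ :- t) :* (con 1ℚ :- t) :* e) :* E) refl (𝔼S n) (ê ^ 4) t ⟩
    D * D * (q * q * ê ^ 4) * 𝔼S n
      ≤⟨ *-monoˡ (0≤* (0≤* 0≤D 0≤D) (0≤* (0≤* 0≤q 0≤q) (0≤^ 4 0≤ê))) (𝔼S-upper l) ⟩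
    D * D * (q * q * ê ^ 4) * (a * W)
      ≡⟨ solve 5 (λ d f e a w → d :* (f :* e) :* (a :* w) := a :* f :* e :* (d :* w)) refl (D * D) (q * q) (ê ^ 4) a W ⟩
    a * (q * q) * ê ^ 4 * (D * D * W)
      ≤⟨ *-monoˡ (0≤* (0≤* (0≤^ (3 ℕ.* n ∸ 2) 0≤q) (0≤* 0≤q 0≤q)) (0≤^ 4 0≤ê)) (≤-trans (depthSum-upper n ½≤q (1-inv≤1 l)) envelope≤) ⟩
    a * (q * q) * ê ^ 4 * (ι 4 * t + ι 8 * p)
      ≡⟨ cong (λ c → c * ê ^ 4 * (ι 4 * t + ι 8 * p)) aq² ⟩
    p ^ 3 * ê ^ 4 * (ι 4 * t + ι 8 * p)
      ≡⟨ solve 3 (λ p e t → p :* (p :* (p :* con 1ℚ)) :* (e :* (e :* (e :* (e :* con 1ℚ)))) :* (con (ι 4) :* t :+ con (ι 8) :* p) :=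
           con (ι 4) :* t :* e :* (p :* e :* (p :* e :* (p :* e :* con 1ℚ))) :+
           con (ι 8) :* (p :* e :* (p :* e :* (p :* e :* (p :* e :* con 1ℚ))))) refl p ê t ⟩
    ι 4 * t * ê * (p * ê) ^ 3 + ι 8 * (p * ê) ^ 4
      -- The term with `t` has one `ê` more than `p`, which `e≤4` bounds.
      ≤⟨ +-mono-≤ (*-mono (0≤^ 3 0≤pê) (0≤* (0≤* (0≤ι 4) 0≤t) (0≤ι 4)) (*-monoˡ (0≤* (0≤ι 4) 0≤t) (e≤4 k)) (^≤1 3 0≤pê (e-upper k l)))
           (*-monoˡ (0≤ι 8) (^≤1 4 0≤pê (e-upper k l))) ⟩
    ι 4 * t * ι 4 * 1ℚ + ι 8 * 1ℚ
      -- The constant 54 is dictated by the lower bound; here it leaves slack.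
      ≤⟨ ≤-by (t * (ι 68 + ι 648 * (inv 5 - t))) (0≤* 0≤t (0≤+ (0≤ι 68) (0≤* (0≤ι 648) (≤⇒0≤- t≤⅙))))
           (solve 1 (λ t → (con (ι 2) :+ con (ι 54) :* t) :* (con (ι 4) :- con (ι 12) :* t) :=
             con (ι 4) :* t :* con (ι 4) :* con 1ℚ :+ con (ι 8) :* con 1ℚ :+
             t :* (con (ι 68) :+ con (ι 648) :* (con (inv 5) :- t))) refl t) ⟩
    (ι 2 + ι 54 * t) * (ι 4 - ι 12 * t) ∎)
    where
    open ≤-Reasoning
    n = suc l
    t = inv l
    q = 1ℚ - t
    D = 1ℚ - q * q
    ê = Σ1/k! k
    y = normalised l k
    a = q ^ (3 ℕ.* n ∸ 2)
    W = depthSum (q * q) n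
    p = q ^ n
    0≤t = 0≤inv l
    0≤q = 0≤1-inv l
    0≤ê = 0≤e k
    0≤pê = 0≤* (0≤^ n 0≤q) 0≤ê
    0≤y : 0ℚ ≤ y
    0≤y = 0≤* (0≤* (0≤𝔼S n) (0≤* 0≤t 0≤t)) (0≤^ 4 0≤ê)
    0≤D : 0ℚ ≤ D
    0≤D = ≤⇒0≤- (*-mono 0≤q 0≤1 (1-inv≤1 l) (1-inv≤1 l))
    t≤⅙ : t ≤ inv 5
    t≤⅙ = 1/-anti 6 n (s≤s 5≤l)
    ½≤q : ½ ≤ q
    ½≤q = ≤-by (½ - t) (≤⇒0≤- (1/-anti 2 n (s≤s (ℕₚ.≤-trans (s≤s z≤n) 5≤l))))
      (solve 1 (λ t → con 1ℚ :- t := con ½ :+ (con ½ :- t)) refl t)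
    0<c : 0ℚ < ι 4 - ι 12 * t
    0<c = <-≤-trans (positive⁻¹ (ι 2)) (≤-by (ι 12 * (inv 5 - t)) (0≤* (0≤ι 12) (≤⇒0≤- t≤⅙))
      (solve 1 (λ t → con (ι 4) :- con (ι 12) :* t := con (ι 2) :+ con (ι 12) :* (con (inv 5) :- t)) refl t))
    aq² : a * (q * q) ≡ p ^ 3
    aq² = begin-equality
      a * (q * q)              ≡⟨ cong (λ z → a * (q * z)) (*-identityʳ q) ⟨
      a * q ^ 2                ≡⟨ ^-homo-* q (3 ℕ.* n ∸ 2) 2 ⟨
      q ^ (3 ℕ.* n ∸ 2 ℕ.+ 2)  ≡⟨ cong (q ^_) (ℕₚ.m∸n+n≡m (ℕₚ.≤-trans (s≤s (s≤s z≤n)) (ℕₚ.*-monoʳ-≤ 3 {1} {n} (s≤s z≤n)))) ⟩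
      q ^ (3 ℕ.* n)            ≡⟨ cong (q ^_) (ℕₚ.*-comm 3 n) ⟩
      q ^ (n ℕ.* 3)            ≡⟨ ^-assocʳ q n 3 ⟨
      p ^ 3                    ∎
    -- Since `t n = 1`, the terms `4 D (n + 1)` and `− 8` cancel up to order `t`, which leaves `8 p`
    -- as the leading term.
    envelope≤ : envelope q (ι 8) n ≤ ι 4 * t + ι 8 * p
    envelope≤ = begin
      envelope q (ι 8) n
        ≡⟨ solve 3 (λ t N p → con (ι 4) :* (con 1ℚ :- (con 1ℚ :- t) :* (con 1ℚ :- t)) :* (N :+ con 1ℚ) :- con (ι 8) :+ con (ι 8) :* p :=
             con (ι 4) :* (con (ι 2) :- t) :* (t :* N :+ t) :- con (ι 8) :+ con (ι 8) :* p) refl t (ι n) p ⟩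
      ι 4 * (ι 2 - t) * (t * ι n + t) - ι 8 + ι 8 * p
        ≡⟨ cong (λ z → ι 4 * (ι 2 - t) * (z + t) - ι 8 + ι 8 * p) (inv-* l) ⟩
      ι 4 * (ι 2 - t) * (1ℚ + t) - ι 8 + ι 8 * p
        ≤⟨ ≤-by (ι 4 * (t * t)) (0≤* (0≤ι 4) (0≤* 0≤t 0≤t))
             (solve 2 (λ t p → con (ι 4) :* t :+ con (ι 8) :* p :=
                con (ι 4) :* (con (ι 2) :- t) :* (con 1ℚ :+ t) :- con (ι 8) :+ con (ι 8) :* p :+ con (ι 4) :* (t :* t)) refl t p) ⟩
      ι 4 * t + ι 8 * p ∎

  -- Every loss is paid in powers of `q = 1 − s`, where `s = 1/(n − 4)`: one for the envelope, 18
  -- because `q ^ (4 n − 2)` is `p ^ 4 * q ^ 18`, and 8 for replacing `s` by `t = 1/n` twice.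
  -- Bernoulli's inequality for the total of 27 gives `2 (1 − 27 s)`, hence 54.
  normalised-lower : ∀ l k → 1 ℕ.≤ l → suc l ℕ.≤ k → ι 2 - ι 54 * inv l ≤ normalised (4 ℕ.+ l) k
  normalised-lower l@(suc l′) k _ l<k = *-cancelˡ-≤-pos (ι 4) (begin
    ι 4 * (ι 2 - ι 54 * s)
      ≡⟨ solve 1 (λ s → con (ι 4) :* (con (ι 2) :- con (ι 54) :* s) := con (ι 8) :* (con 1ℚ :- con (ι 27) :* s)) refl s ⟩
    ι 8 * (1ℚ - ι 27 * s)
      ≤⟨ *-monoˡ (0≤ι 8) (bernoulli 27 0≤s (inv≤1 l)) ⟩
    ι 8 * q ^ 27
      ≡⟨ cong (ι 8 *_) (trans (^-homo-* q 19 8) (trans (cong (_* q ^ 8) (^-homo-* q 1 18)) (cong (λ z → z * q ^ 18 * q ^ 8) (*-identityʳ q)))) ⟩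
    ι 8 * (q * q ^ 18 * q ^ 8)
      ≡⟨ cong (λ z → ι 8 * z) (*-identityʳ (q * q ^ 18 * q ^ 8)) ⟨
    ι 8 * (q * q ^ 18 * q ^ 8 * 1ℚ)
      ≤⟨ *-monoˡ (0≤ι 8) (*-monoˡ (0≤* (0≤* 0≤q (0≤^ 18 0≤q)) (0≤^ 8 0≤q)) (1≤^ 4 (e-lower k l′ l<k))) ⟩
    ι 8 * (q * q ^ 18 * q ^ 8 * (p * ê) ^ 4)
      ≡⟨ cong (λ z → ι 8 * (q * q ^ 18 * q ^ 8 * z)) (^-distrib-* p ê 4) ⟩
    ι 8 * (q * q ^ 18 * q ^ 8 * (p ^ 4 * ê ^ 4))
      ≡⟨ solve 5 (λ q r f p e → con (ι 8) :* (q :* r :* f :* (p :* e)) := p :* r :* (con (ι 8) :* q) :* (f :* e)) refl q (q ^ 18) (q ^ 8) (p ^ 4) (ê ^ 4) ⟩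
    p ^ 4 * q ^ 18 * (ι 8 * q) * (q ^ 8 * ê ^ 4)
      ≡⟨ cong (λ z → z * (ι 8 * q) * (q ^ 8 * ê ^ 4)) aqⁿ ⟨
    a * q ^ n * (ι 8 * q) * (q ^ 8 * ê ^ 4)
      ≡⟨ solve 4 (λ a r q f → a :* r :* (con (ι 8) :* q) :* f := a :* (con (ι 8) :* q :* r) :* f) refl a (q ^ n) q (q ^ 8 * ê ^ 4) ⟩
    a * (ι 8 * q * q ^ n) * (q ^ 8 * ê ^ 4)
      ≤⟨ *-monoʳ 0≤f (*-monoˡ 0≤a (≤-trans ≤envelope (depthSum-lower n 0≤q (1-inv≤1 l)))) ⟩
    a * (D * D * W) * (q ^ 8 * ê ^ 4)
      ≡⟨ solve 4 (λ a d w f → a :* (d :* w) :* f := d :* (a :* w) :* f) refl a (D * D) W (q ^ 8 * ê ^ 4) ⟩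
    D * D * (a * W) * (q ^ 8 * ê ^ 4)
      ≤⟨ *-monoʳ 0≤f (*-monoˡ (0≤* 0≤D 0≤D) (𝔼S-lower l)) ⟩
    D * D * 𝔼S n * (q ^ 8 * ê ^ 4)
      ≤⟨ *-monoʳ 0≤f (*-monoʳ (0≤𝔼S n) (*-mono 0≤D (0≤* (0≤ι 2) 0≤s) D≤2s D≤2s)) ⟩
    ι 2 * s * (ι 2 * s) * 𝔼S n * (q ^ 8 * ê ^ 4)
      ≡⟨ cong (λ z → ι 2 * s * (ι 2 * s) * 𝔼S n * (z * ê ^ 4)) (^-homo-* q 4 4) ⟩
    ι 2 * s * (ι 2 * s) * 𝔼S n * (q ^ 4 * q ^ 4 * ê ^ 4)
      ≡⟨ solve 4 (λ s E r e → con (ι 2) :* s :* (con (ι 2) :* s) :* E :* (r :* r :* e) := con (ι 4) :* (E :* (s :* r :* (s :* r)) :* e)) refl s (𝔼S n) (q ^ 4) (ê ^ 4) ⟩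
    ι 4 * (𝔼S n * (s * q ^ 4 * (s * q ^ 4)) * ê ^ 4)
      ≤⟨ *-monoˡ (0≤ι 4) (*-monoʳ (0≤^ 4 0≤ê) (*-monoˡ (0≤𝔼S n) (*-mono (0≤* 0≤s (0≤^ 4 0≤q)) 0≤t sq⁴≤t sq⁴≤t))) ⟩
    ι 4 * normalised (4 ℕ.+ l) k ∎)
    where
    open ≤-Reasoning
    n = 5 ℕ.+ l
    s = inv l
    t = inv (4 ℕ.+ l)
    q = 1ℚ - s
    D = 1ℚ - q * q
    ê = Σ1/k! k
    a = q ^ (3 ℕ.* n ∸ 2)
    W = depthSum (q * q) n
    p = q ^ l
    0≤s = 0≤inv l
    0≤t = 0≤inv (4 ℕ.+ l)
    0≤q = 0≤1-inv l
    0≤ê = 0≤e k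
    0≤a = 0≤^ (3 ℕ.* n ∸ 2) 0≤q
    0≤f = 0≤* (0≤^ 8 0≤q) (0≤^ 4 0≤ê)
    0≤D : 0ℚ ≤ D
    0≤D = ≤⇒0≤- (*-mono 0≤q 0≤1 (1-inv≤1 l) (1-inv≤1 l))
    D≤2s : D ≤ ι 2 * s
    D≤2s = ≤-by (s * s) (0≤* 0≤s 0≤s)
      (solve 1 (λ s → con (ι 2) :* s := con 1ℚ :- (con 1ℚ :- s) :* (con 1ℚ :- s) :+ s :* s) refl s)
    ιn : ι n ≡ ι 4 + ι (suc l)
    ιn = ι-+ 4 (suc l)
    aqⁿ : a * q ^ n ≡ p ^ 4 * q ^ 18
    aqⁿ = begin-equality
      a * q ^ n                        ≡⟨ ^-homo-* q (3 ℕ.* n ∸ 2) n ⟨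
      q ^ (3 ℕ.* n ∸ 2 ℕ.+ n)          ≡⟨ cong (λ z → q ^ (z ∸ 2 ℕ.+ n)) (ℕ-solve 1 (λ l → κ 3 ⊗ (κ 5 ⊕ l) ⊜ κ 2 ⊕ (κ 13 ⊕ κ 3 ⊗ l)) refl l) ⟩
      q ^ (13 ℕ.+ 3 ℕ.* l ℕ.+ n)       ≡⟨ cong (q ^_) (ℕ-solve 1 (λ l → κ 13 ⊕ κ 3 ⊗ l ⊕ (κ 5 ⊕ l) ⊜ l ⊗ κ 4 ⊕ κ 18) refl l) ⟩
      q ^ (l ℕ.* 4 ℕ.+ 18)             ≡⟨ ^-homo-* q (l ℕ.* 4) 18 ⟩
      q ^ (l ℕ.* 4) * q ^ 18           ≡⟨ cong (_* q ^ 18) (^-assocʳ q l 4) ⟨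
      p ^ 4 * q ^ 18                   ∎
      where open ℕ-Solver.+-*-Solver using () renaming (solve to ℕ-solve; _:+_ to _⊕_; _:*_ to _⊗_; _:=_ to _⊜_; con to κ)
    ≤envelope : ι 8 * q * q ^ n ≤ envelope q (ι 8 - ι 4 * D) n
    ≤envelope = begin
      ι 8 * q * q ^ n
        -- The part free of `q ^ n` is `36 s − 20 s²`, nonnegative and of order `s`, and
        -- `8 − 4 D = 8 q + 4 s²`.
        ≤⟨ ≤-by (ι 20 * (s * q) + ι 16 * s + ι 4 * (s * s) * q ^ n)
             (0≤+ (0≤+ (0≤* (0≤ι 20) (0≤* 0≤s 0≤q)) (0≤* (0≤ι 16) 0≤s)) (0≤* (0≤* (0≤ι 4) (0≤* 0≤s 0≤s)) (0≤^ n 0≤q)))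
             (solve 2 (λ s r → con (ι 4) :* (con (ι 2) :- s) :* (con 1ℚ :+ con (ι 5) :* s) :- con (ι 8) :+
                  (con (ι 8) :- con (ι 4) :* (con 1ℚ :- (con 1ℚ :- s) :* (con 1ℚ :- s))) :* r :=
                con (ι 8) :* (con 1ℚ :- s) :* r :+
                (con (ι 20) :* (s :* (con 1ℚ :- s)) :+ con (ι 16) :* s :+ con (ι 4) :* (s :* s) :* r)) refl s (q ^ n)) ⟩
      ι 4 * (ι 2 - s) * (1ℚ + ι 5 * s) - ι 8 + (ι 8 - ι 4 * D) * q ^ n
        ≡⟨ cong (λ z → ι 4 * (ι 2 - s) * (z + ι 5 * s) - ι 8 + (ι 8 - ι 4 * D) * q ^ n) (inv-* l) ⟨
      ι 4 * (ι 2 - s) * (s * ι (suc l) + ι 5 * s) - ι 8 + (ι 8 - ι 4 * D) * q ^ n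
        ≡⟨ solve 3 (λ s M g → con (ι 4) :* (con (ι 2) :- s) :* (s :* M :+ con (ι 5) :* s) :- con (ι 8) :+ g :=
             con (ι 4) :* (con 1ℚ :- (con 1ℚ :- s) :* (con 1ℚ :- s)) :* (con (ι 4) :+ M :+ con 1ℚ) :- con (ι 8) :+ g)
             refl s (ι (suc l)) ((ι 8 - ι 4 * D) * q ^ n) ⟩
      ι 4 * D * (ι 4 + ι (suc l) + 1ℚ) - ι 8 + (ι 8 - ι 4 * D) * q ^ n
        ≡⟨ cong (λ z → ι 4 * D * (z + 1ℚ) - ι 8 + (ι 8 - ι 4 * D) * q ^ n) ιn ⟨
      envelope q (ι 8 - ι 4 * D) n ∎
    -- Because `s n = 1 + 4 s` and `t n = 1`, the claim reduces to `(1 − s)⁴ (1 + 4 s) ≤ 1`.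
    sq⁴≤t : s * q ^ 4 ≤ t
    sq⁴≤t = begin
      s * q ^ 4
        ≡⟨ *-identityˡ (s * q ^ 4) ⟨
      1ℚ * (s * q ^ 4)
        ≡⟨ cong (_* (s * q ^ 4)) (inv-* (4 ℕ.+ l)) ⟨
      t * ι n * (s * q ^ 4)
        ≡⟨ cong (λ z → t * z * (s * q ^ 4)) ιn ⟩
      t * (ι 4 + ι (suc l)) * (s * q ^ 4)
        ≡⟨ solve 4 (λ t M s r → t :* (con (ι 4) :+ M) :* (s :* r) := t :* (r :* (s :* M :+ con (ι 4) :* s))) refl t (ι (suc l)) s (q ^ 4) ⟩
      t * (q ^ 4 * (s * ι (suc l) + ι 4 * s))
        ≡⟨ cong (λ z → t * (q ^ 4 * (z + ι 4 * s))) (inv-* l) ⟩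
      t * (q ^ 4 * (1ℚ + ι 4 * s))
        ≤⟨ *-monoˡ 0≤t (≤-by (s * s * (1ℚ + ι 2 * q + ι 3 * (q * q) + ι 4 * (q * q * q)))
             (0≤* (0≤* 0≤s 0≤s) (0≤+ (0≤+ (0≤+ 0≤1 (0≤* (0≤ι 2) 0≤q)) (0≤* (0≤ι 3) (0≤* 0≤q 0≤q))) (0≤* (0≤ι 4) (0≤* (0≤* 0≤q 0≤q) 0≤q))))
             (solve 1 (λ s → con 1ℚ := (con 1ℚ :- s) :* ((con 1ℚ :- s) :* ((con 1ℚ :- s) :* ((con 1ℚ :- s) :* con 1ℚ))) :* (con 1ℚ :+ con (ι 4) :* s) :+
                s :* s :* (con 1ℚ :+ con (ι 2) :* (con 1ℚ :- s) :+ con (ι 3) :* ((con 1ℚ :- s) :* (con 1ℚ :- s)) :+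
                  con (ι 4) :* ((con 1ℚ :- s) :* (con 1ℚ :- s) :* (con 1ℚ :- s)))) refl s)) ⟩
      t * 1ℚ
        ≡⟨ *-identityʳ t ⟩
      t ∎

  normalised-close : ∀ l k → 1 ℕ.≤ l → 5 ℕ.+ l ℕ.≤ k → ∣ normalised (4 ℕ.+ l) k - ι 2 ∣ ≤ ι 54 * inv l
  normalised-close l k 1≤l n≤k = ∣∣-≤
    (≤-by _ (≤⇒0≤- above) (solve 2 (λ y b → b := y :- con (ι 2) :+ (con (ι 2) :+ b :- y)) refl y b))
    (≤-by _ (≤⇒0≤- below) (solve 2 (λ y b → b := :- (y :- con (ι 2)) :+ (y :- (con (ι 2) :- b))) refl y b))
    where
    y = normalised (4 ℕ.+ l) k
    b = ι 54 * inv l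
    above : y ≤ ι 2 + b
    above = ≤-trans (normalised-upper (4 ℕ.+ l) k (ℕₚ.+-monoʳ-≤ 4 1≤l))
      (+-monoʳ-≤ (ι 2) (*-monoˡ (0≤ι 54) (1/-anti (suc l) (5 ℕ.+ l) (ℕₚ.m≤n+m (suc l) 4))))
    below : ι 2 - b ≤ y
    below = normalised-lower l k 1≤l (ℕₚ.≤-trans (ℕₚ.m≤n+m (suc l) 4) n≤k)

  -- Transfer to the two limits.

  0<e⁴ : ∀ k → 0ℚ < Σ1/k! (suc k) ^ 4
  0<e⁴ k = <-≤-trans 0<1 (1≤^ 4 (1≤e k))

  μ≡ : ∀ l → μ (suc l) ≡ 𝔼S (suc l) * (inv l * inv l)
  μ≡ l = cong (𝔼S (suc l) *_) (1/-* (suc l) (suc l))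

  -- The difference is the error of `normalised` times `1/E`, and `1/E ≤ 1` because a nonempty
  -- partial sum of `e` is at least 1.
  μ-close : ∀ l k → 1 ℕ.≤ l → 5 ℕ.+ l ℕ.≤ k → ∣ μ (5 ℕ.+ l) - ι 2 * recip (Σ1/k! k ^ 4) ∣ ≤ ι 54 * inv l
  μ-close l k@(suc k′) 1≤l n≤k = begin
    ∣ μ (5 ℕ.+ l) - ι 2 * r ∣
      ≡⟨ cong (λ z → ∣ z - ι 2 * r ∣) (μ≡ (4 ℕ.+ l)) ⟩
    ∣ x - ι 2 * r ∣
      ≡⟨ cong (λ z → ∣ z - ι 2 * r ∣) (trans (sym (*-identityʳ x)) (cong (x *_) (sym E*r))) ⟩
    ∣ x * (E * r) - ι 2 * r ∣
      ≡⟨ cong ∣_∣ (solve 3 (λ x E r → x :* (E :* r) :- con (ι 2) :* r := (x :* E :- con (ι 2)) :* r) refl x E r) ⟩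
    ∣ (x * E - ι 2) * r ∣
      ≡⟨ ∣p*q∣≡∣p∣*∣q∣ (x * E - ι 2) r ⟩
    ∣ x * E - ι 2 ∣ * ∣ r ∣
      ≡⟨ cong (∣ x * E - ι 2 ∣ *_) (0≤p⇒∣p∣≡p 0≤r) ⟩
    ∣ x * E - ι 2 ∣ * r
      ≤⟨ *-mono 0≤r (0≤* (0≤ι 54) (0≤inv l)) (normalised-close l k 1≤l n≤k) r≤1 ⟩
    ι 54 * inv l * 1ℚ
      ≡⟨ *-identityʳ _ ⟩
    ι 54 * inv l ∎
    where
    open ≤-Reasoning
    E = Σ1/k! k ^ 4
    r = recip E
    x = 𝔼S (5 ℕ.+ l) * (inv (4 ℕ.+ l) * inv (4 ℕ.+ l))
    E*r : E * r ≡ 1ℚ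
    E*r = *-recip E (pos≢0 (0<e⁴ k′))
    0≤r : 0ℚ ≤ r
    0≤r = <⇒≤ (recip-pos (0<e⁴ k′))
    r≤1 : r ≤ 1ℚ
    r≤1 = begin
      r        ≡⟨ *-identityˡ r ⟨
      1ℚ * r   ≤⟨ *-monoʳ 0≤r (1≤^ 4 (1≤e k′)) ⟩
      E * r    ≡⟨ E*r ⟩
      1ℚ       ∎

  recip-unique : ∀ {b c} → b * c ≡ 1ℚ → recip b ≡ c
  recip-unique {b} {c} bc≡1 = begin-equality
    recip b            ≡⟨ *-identityʳ (recip b) ⟨
    recip b * 1ℚ       ≡⟨ cong (recip b *_) bc≡1 ⟨
    recip b * (b * c)  ≡⟨ solve 3 (λ r b c → r :* (b :* c) := b :* r :* c) refl (recip b) b c ⟩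
    b * recip b * c    ≡⟨ cong (_* c) (*-recip b b≢0) ⟩
    1ℚ * c             ≡⟨ *-identityˡ c ⟩
    c                  ∎
    where
    open ≤-Reasoning
    b≢0 : b ≢ 0ℚ
    b≢0 b≡0 = 1≢0 (trans (sym bc≡1) (trans (cong (_* c) b≡0) (*-zeroˡ c)))

  quotient-close : ∀ l k → 1 ℕ.≤ l → 5 ℕ.+ l ℕ.≤ k → let n = 5 ℕ.+ l in
    ∣ 𝔼S n * recip (ι 2 * ι n ^ 2 * recip (Σ1/k! k ^ 4)) - 1ℚ ∣ ≤ ι 54 * inv l
  quotient-close l k@(suc k′) 1≤l n≤k = begin
    ∣ 𝔼S n * recip (ι 2 * ι n ^ 2 * r) - 1ℚ ∣
      ≡⟨ cong (λ z → ∣ 𝔼S n * z - 1ℚ ∣) (recip-unique {ι 2 * ι n ^ 2 * r} {c} b*c) ⟩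
    ∣ 𝔼S n * c - 1ℚ ∣
      ≡⟨ cong ∣_∣ (solve 3 (λ S t E → S :* (con ½ :* (t :* t :* E)) :- con 1ℚ := con ½ :* (S :* (t :* t) :* E :- con (ι 2))) refl (𝔼S n) t E) ⟩
    ∣ ½ * (normalised (4 ℕ.+ l) k - ι 2) ∣
      ≡⟨ ∣p*q∣≡∣p∣*∣q∣ ½ (normalised (4 ℕ.+ l) k - ι 2) ⟩
    ½ * ∣ normalised (4 ℕ.+ l) k - ι 2 ∣
      ≤⟨ *-mono (0≤∣p∣ (normalised (4 ℕ.+ l) k - ι 2)) 0≤1 ½≤1 (normalised-close l k 1≤l n≤k) ⟩
    1ℚ * (ι 54 * inv l)
      ≡⟨ *-identityˡ _ ⟩
    ι 54 * inv l ∎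
    where
    open ≤-Reasoning
    n = 5 ℕ.+ l
    t = inv (4 ℕ.+ l)
    E = Σ1/k! k ^ 4
    r = recip E
    -- The exact reciprocal of `2 n² / E`; with it the error of the quotient is half the error of
    -- `normalised`.
    c = ½ * (t * t * E)
    ½≤1 : ½ ≤ 1ℚ
    ½≤1 = 1/-anti 1 2 (s≤s z≤n)
    b*c : ι 2 * ι n ^ 2 * r * c ≡ 1ℚ
    b*c = begin-equality
      ι 2 * ι n ^ 2 * r * c
        ≡⟨ solve 4 (λ N r t E → con (ι 2) :* (N :* (N :* con 1ℚ)) :* r :* (con ½ :* (t :* t :* E)) := (t :* N) :* (t :* N) :* (E :* r)) refl (ι n) r t E ⟩
      t * ι n * (t * ι n) * (E * r)
        ≡⟨ cong₂ (λ u v → u * u * v) (inv-* (4 ℕ.+ l)) (*-recip E (pos≢0 (0<e⁴ k′))) ⟩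
      1ℚ ∎

  -- The rate is required only for `k ≥ n`: the index from which two reals are compared may depend
  -- on `n`.
  ⟶-rate : ∀ (a : Sequence) L →
    (∀ l k → 1 ℕ.≤ l → 5 ℕ.+ l ℕ.≤ k → ∣ seq (a (5 ℕ.+ l)) k - seq L k ∣ ≤ ι 54 * inv l) →
    a ⟶ L
  ⟶-rate a L close ε (δ , 0<δ , M , δ≤ε) = 6 ℕ.+ N , within
    where
    open ≤-Reasoning
    -- Half of `δ` bounds the error, the other half is the gap that strict inequality of reals
    -- demands.
    η = ½ * δ
    -- Equal to `1/54`, since `inv` is shifted by one.
    c = inv 53
    0<η = *-pos 0<½ 0<δ
    small = archimedean (c * η) (*-pos (1/-pos 54) 0<η)
    N = proj₁ small
    within : ∀ n .{{_ : ℕ.NonZero n}} → 6 ℕ.+ N ℕ.≤ n → Defs.∣ a n Defs.- L ∣ Defs.< ε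
    within (suc (suc (suc (suc (suc l))))) (s≤s (s≤s (s≤s (s≤s (s≤s N<l))))) =
      η , 0<η , M ℕ.⊔ (5 ℕ.+ l) , λ k k≥ → begin
        ∣ seq (a (5 ℕ.+ l)) k - seq L k ∣ + η
          ≤⟨ +-monoˡ-≤ η (close l k (ℕₚ.≤-trans (s≤s z≤n) N<l) (ℕₚ.m⊔n≤o⇒n≤o M (5 ℕ.+ l) k≥)) ⟩
        ι 54 * inv l + η
          ≤⟨ +-monoˡ-≤ η (*-monoˡ (0≤ι 54) (≤-trans (1/-anti (suc N) (suc l) (ℕₚ.≤-trans N<l (ℕₚ.n≤1+n l))) (proj₂ small))) ⟩
        ι 54 * (c * η) + η
          ≡⟨ cong (_+ η) (solve 1 (λ η → con (ι 54) :* (con c :* η) := η) refl η) ⟩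
        η + η
          ≡⟨ half+half δ ⟩
        δ
          ≡⟨ +-identityˡ δ ⟨
        0ℚ + δ
          ≤⟨ δ≤ε k (ℕₚ.m⊔n≤o⇒m≤o M (5 ℕ.+ l) k≥) ⟩
        seq ε k ∎

import Data.Nat as ℕ
open import Data.Product using (_×_; _,_)
open import Defs
open Asymptotics using (⟶-rate; quotient-close; μ-close)

leading-nonZero : ∀ n .{{_ : ℕ.NonZero n}} → NonZero ((fromℕ 2 * fromℕ n ^ 2) ÷ e ^ 4)
leading-nonZero n = ÷-nonZero {x = fromℕ 2 * fromℕ n ^ 2} {y = e ^ 4}
  (*-nonZero {x = fromℕ 2} {y = fromℕ n ^ 2} (fromℕ-nonZero 2) (^-nonZero {x = fromℕ n} 2 (fromℕ-nonZero n)))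

theorem1p3 : ((λ n → fromℚ (𝔼S n)) ∼ (λ n → (fromℕ 2 * fromℕ n ^ 2) ÷ e ^ 4))
    × ((λ n → fromℚ (μ n)) ⟶ fromℕ 2 ÷ e ^ 4)
theorem1p3 =
  (leading-nonZero ,
   ⟶-rate (λ n → _÷_ (fromℚ (𝔼S n)) ((fromℕ 2 * fromℕ n ^ 2) ÷ e ^ 4) {{leading-nonZero n}}) 1ℝ quotient-close) ,
  ⟶-rate (λ n → fromℚ (μ n)) (fromℕ 2 ÷ e ^ 4) μ-close
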